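{- Let $S$ be a set of $n=|S|$ weighted activities, sorted by end time. The Type 2 activity selection algorithm (described in the context), which solves the weighted activity selection problem on $S$, takes $O(n\log n)$ work and $O(\mathrm{rank}(S)\log n)$ span.
   Context: Problem: activity $A_i$ has start time $s_i$, end time $e_i$ with $s_i<e_i$, and weight $w_i$. A set of activities is feasible if its members are pairwise non-overlapping ($A_i,A_j$ are non-overlapping if $e_j\le s_i$ or $e_i\le s_j$). The goal is to find a feasible set of maximum total weight. Define $dp[i]=w_i+\max\bigl(0,\max_{j:\,e_j\le s_i}dp[j]\bigr)$, the maximum weight of a feasible set that contains $A_i$ and is contained in $\{A_1,\dots,A_i\}$; the algorithm computes all $dp[i]$. $\mathrm{rank}(S)$ is the maximum number of pairwise non-overlapping activities in $S$; the rank of $A_i$ is the maximum size of a feasible set containing $A_i$ and contained in $\{A_1,\dots,A_i\}$. Type 2 algorithm: for every activity $x$ for which some activity ends no later than $s_x$, find by search its pivot $p_x$, an activity of latest start time among all activities with end time at most $s_x$. Store all pairs $(p_x,x)$ in a search-tree multi-map $T_{\mathrm{pivot}}$. Start with the frontier of all activities of rank $1$ (those with no pivot). In each round, compute in parallel the DP value of each activity $i$ in the frontier by a range-maximum query over end times at most $s_i$ on a balanced search tree $T_{\mathrm{DP}}$ (keyed by end time, augmented with the maximum of the DP values computed so far), update these DP values in $T_{\mathrm{DP}}$ as a batch, and let the next frontier be all $z$ with $(y,z)\in T_{\mathrm{pivot}}$ for some $y$ in the current frontier. Stop when the frontier is empty. Tree costs: on $n$ entries, the augmented tree can be constructed from a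 sorted sequence in $O(n)$ work and $O(\log n)$ span; a range query takes $O(\log n)$ work; a batch of $m\le n$ updates takes $O(m\log n)$ work and $O(\log n)$ span. Model: work-span binary-forking model. Threads share memory and run standard RAM instructions and a fork instruction that creates two child threads (the parent is suspended until both terminate), together with the atomic test-and-set. Work is the total number of instructions; span is the length of the longest chain of dependent instructions. -}

module Defs where

open import Level using (0ℓ)
open import Algebra.Structures using (IsCommutativeMonoid)
open import Data.Bool using (true; false)
open import Data.Fin as Fin using (Fin; zero; suc; _↑ˡ_; _↑ʳ_; splitAt)
open import Data.Fin.Subset using (Subset; _∈_; ∣_∣)
open import Data.List as List using (List; []; _∷_)
open import Data.List.Extrema as Extrema using ()
open import Data.List.Relation.Binary.Permutation.Propositional using (_↭_)
open import Data.Maybe as Maybe using (Maybe; just; nothing)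
open import Data.Nat as ℕ using (ℕ; zero; suc; _+_; _*_; _⊔_; ⌊_/2⌋; ⌈_/2⌉)
open import Data.Nat.Induction using (Acc; acc; <-wellFounded)
open import Data.Nat.Logarithm using (⌊log₂_⌋)
open import Data.Nat.Properties using (⌊n/2⌋<n; ⌈n/2⌉<n; ⌊n/2⌋+⌈n/2⌉≡n)
open import Data.Product using (∃; _×_; _,_; proj₁; proj₂)
open import Data.Sum using (_⊎_; [_,_]′)
open import Data.Vec as Vec using (Vec; lookup; []; _∷_)
open import Data.Vec.Membership.Propositional using () renaming (_∈_ to _∈ᵛ_; _∉_ to _∉ᵛ_)
open import Data.Vec.Relation.Unary.Unique.Propositional using (Unique)
open import Relation.Binary.Bundles using (DecTotalOrder)
open import Relation.Binary.PropositionalEquality using (_≡_; _≢_; subst)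
open import Relation.Binary.Structures using (IsDecTotalOrder)
import Algebra.Construct.NaturalChoice.Max as NaturalMax
import Relation.Binary.Properties.Poset as PosetProperties

------------------------------------------------------------------------
-- Work-span cost model with binary forking

-- The series-parallel unfolding of a race-free computation returning a
-- value in A.  `tick p` executes one RAM instruction and continues as
-- p.  `fork p q k` creates the two child threads p and q, both of which
-- see everything computed so far, suspends the parent until both have
-- terminated, and continues as k applied to their results.
data Comp (A : Set) : Set₁ where
  ret  : A → Comp A
  tick : Comp A → Comp A
  fork : {B C : Set} → Comp B → Comp C → (B → C → Comp A) → Comp A

run : {A : Set} → Comp A → A
run (ret a)      = a
run (tick p)     = run p
run (fork p q k) = run (k (run p) (run q))

work : {A : Set} → Comp A → ℕ
work (ret _)      = 0
work (tick p)     = 1 + work p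
work (fork p q k) = 1 + (work p + work q) + work (k (run p) (run q))

span : {A : Set} → Comp A → ℕ
span (ret _)      = 0
span (tick p)     = 1 + span p
span (fork p q k) = 1 + (span p ⊔ span q) + span (k (run p) (run q))

infixl 1 _>>=_

_>>=_ : {A B : Set} → Comp A → (A → Comp B) → Comp B
ret a      >>= f = f a
tick p     >>= f = tick (p >>= f)
fork p q k >>= f = fork p q λ b c → k b c >>= f

-- One RAM instruction (load, store, arithmetic, comparison, allocation
-- of a record, projection) with result a.
instr : {A : Set} → A → Comp A
instr a = tick (ret a)

-- O(log n) in a hypothesis is written as a multiple of lg n, so that it
-- is meaningful also for n ≤ 1.
lg : ℕ → ℕ
lg n = suc ⌊log₂ n ⌋

------------------------------------------------------------------------
-- Parallel loops

module _ (A : ℕ → Set) (none : A 0)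
         (join : ∀ {k l} → A k → A l → Comp (A (k + l))) where

  -- Divide and conquer over m iterations: the index range is halved and
  -- the two halves are forked.
  parReduce : ∀ m → Acc ℕ._<_ m → (Fin m → Comp (A 1)) → Comp (A m)
  parReduce zero              _        f = ret none
  parReduce (suc zero)        _        f = f zero
  parReduce m@(suc (suc m-2)) (acc rs) f =
    tick (fork
      (parReduce ⌊ m /2⌋ (rs (⌊n/2⌋<n (suc m-2))) λ i → f (at (i ↑ˡ ⌈ m /2⌉)))
      (parReduce ⌈ m /2⌉ (rs (⌈n/2⌉<n m-2))       λ i → f (at (⌊ m /2⌋ ↑ʳ i)))
      (λ a b → join a b >>= λ c → ret (subst A (⌊n/2⌋+⌈n/2⌉≡n m) c)))
    where
    at : Fin (⌊ m /2⌋ + ⌈ m /2⌉) → Fin m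
    at = subst Fin (⌊n/2⌋+⌈n/2⌉≡n m)

-- Allocates an array of m cells and fills it by a parallel loop.
-- Iteration i performs the store into cell i.  The two child threads
-- fill adjacent slices of that one array, so _++_ stands for no
-- instruction.
parFor : {B : Set} (m : ℕ) → (Fin m → Comp B) → Comp (Vec B m)
parFor {B} m f =
  tick (parReduce (Vec B) [] (λ xs ys → ret (xs Vec.++ ys)) m (<-wellFounded m)
         λ i → f i >>= λ b → instr (b ∷ []))

-- Sequences of values held at the leaves of a binary tree, every node of
-- which stores the number of values below it.
data Rope (B : Set) : Set where
  empty : Rope B
  leaf  : B → Rope B
  node  : Rope B → Rope B → Rope B

module _ {B : Set} where

  size : Rope B → ℕ
  size empty      = 0
  size (leaf _)   = 1
  size (node l r) = size l + size r

  height : Rope B → ℕ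
  height empty      = 0
  height (leaf _)   = 0
  height (node l r) = 1 + (height l ⊔ height r)

  toList : Rope B → List B
  toList empty      = []
  toList (leaf b)   = b ∷ []
  toList (node l r) = toList l List.++ toList r

  nth : (r : Rope B) → Fin (size r) → Comp B
  nth empty      ()
  nth (leaf b)   _ = instr b
  nth (node l r) i = instr (splitAt (size l) i) >>= [ nth l , nth r ]′

Array : Set → Set
Array B = ∃ (Vec B)

-- Concatenates in parallel the sequences f 0, …, f (m - 1) into one array.
collect : {B : Set} (m : ℕ) → (Fin m → Comp (Rope B)) → Comp (Array B)
collect {B} m f =
  parReduce (λ _ → Rope B) empty (λ l r → instr (node l r)) m (<-wellFounded m) f >>= λ r →
  tick (parFor (size r) (nth r)) >>= λ xs →
  ret (size r , xs)

------------------------------------------------------------------------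
-- Balanced search trees

-- The trees enter through their specification and cost bounds only.
-- Test-and-set is not needed outside of their batch operations.

module _ (keys values : DecTotalOrder 0ℓ 0ℓ 0ℓ) where
  private
    module K = DecTotalOrder keys
    module V = DecTotalOrder values

  -- An entry has a key and carries at most one value.
  Entry : Set
  Entry = K.Carrier × Maybe V.Carrier

  Sorted : ∀ {n} → Vec Entry n → Set
  Sorted xs = ∀ {i j} → i Fin.≤ j → proj₁ (lookup xs i) K.≤ proj₁ (lookup xs j)

  -- The result is a largest of the values present at keys up to k, with
  -- its position, or nothing if there are none.
  IsRangeMax : ∀ {n} → (Fin n → Entry) → K.Carrier → Maybe (Fin n × V.Carrier) → Set
  IsRangeMax e k nothing        = ∀ j → proj₁ (e j) K.≤ k → proj₂ (e j) ≡ nothing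
  IsRangeMax e k (just (i , v)) =
    proj₁ (e i) K.≤ k × proj₂ (e i) ≡ just v ×
    (∀ j {u} → proj₁ (e j) K.≤ k → proj₂ (e j) ≡ just u → u V.≤ v)

  -- Search trees over n entries, augmented with the maximum of the
  -- values present.  Entries are addressed by their position in the
  -- sorted sequence from which the tree is built.
  record RangeMaxTrees : Set₁ where
    field
      Tree     : ℕ → Set
      entry    : ∀ {n} → Tree n → Fin n → Entry
      build    : ∀ {n} → Vec Entry n → Comp (Tree n)
      rangeMax : ∀ {n} → Tree n → K.Carrier → Comp (Maybe (Fin n × V.Carrier))
      update   : ∀ {n m} → Tree n → Vec (Fin n × V.Carrier) m → Comp (Tree n)

      build-correct    : ∀ {n} (xs : Vec Entry n) → Sorted xs → ∀ i →
                         entry (run (build xs)) i ≡ lookup xs i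
      rangeMax-correct : ∀ {n} (T : Tree n) (k : K.Carrier) →
                         IsRangeMax (entry T) k (run (rangeMax T k))
      update-new       : ∀ {n m} (T : Tree n) (us : Vec (Fin n × V.Carrier) m) →
                         Unique (Vec.map proj₁ us) → ∀ {i v} → (i , v) ∈ᵛ us →
                         entry (run (update T us)) i ≡ (proj₁ (entry T i) , just v)
      update-old       : ∀ {n m} (T : Tree n) (us : Vec (Fin n × V.Carrier) m) →
                         Unique (Vec.map proj₁ us) → ∀ {i} → i ∉ᵛ Vec.map proj₁ us →
                         entry (run (update T us)) i ≡ entry T i

      -- The constant of all O(·) bounds below.  Bounds linear in a size
      -- are stated with that size plus one, to cover empty trees and
      -- batches.
      c : ℕ

      build-work    : ∀ {n} (xs : Vec Entry n) → Sorted xs → work (build xs) ℕ.≤ c * suc n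
      build-span    : ∀ {n} (xs : Vec Entry n) → Sorted xs → span (build xs) ℕ.≤ c * lg n
      rangeMax-work : ∀ {n} (T : Tree n) (k : K.Carrier) → work (rangeMax T k) ℕ.≤ c * lg n
      update-work   : ∀ {n m} (T : Tree n) (us : Vec (Fin n × V.Carrier) m) →
                      Unique (Vec.map proj₁ us) → m ℕ.≤ n →
                      work (update T us) ℕ.≤ c * (suc m * lg n)
      update-span   : ∀ {n m} (T : Tree n) (us : Vec (Fin n × V.Carrier) m) →
                      Unique (Vec.map proj₁ us) → m ℕ.≤ n →
                      span (update T us) ℕ.≤ c * lg n

-- Search-tree multi-maps from Fin n to Fin n.  A map is made from the
-- empty one by a batch of insertions.  A range query for one key
-- returns, without copying, the part of the balanced tree holding the
-- values of that key; hence the bound on its height.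
record MultiMaps : Set₁ where
  field
    MultiMap  : ℕ → Set
    pairs     : ∀ {n} → MultiMap n → List (Fin n × Fin n)
    fromPairs : ∀ {n m} → Vec (Fin n × Fin n) m → Comp (MultiMap n)
    find      : ∀ {n} → MultiMap n → Fin n → Comp (Rope (Fin n))

    fromPairs-correct : ∀ {n m} (ps : Vec (Fin n × Fin n) m) →
                        pairs (run (fromPairs ps)) ↭ Vec.toList ps
    find-correct      : ∀ {n} (M : MultiMap n) y → toList (run (find M y)) ↭
                        List.map proj₂ (List.filter (λ p → proj₁ p Fin.≟ y) (pairs M))

    c : ℕ

    fromPairs-work : ∀ {n m} (ps : Vec (Fin n × Fin n) m) → m ℕ.≤ n →
                     work (fromPairs ps) ℕ.≤ c * (suc m * lg n)
    fromPairs-span : ∀ {n m} (ps : Vec (Fin n × Fin n) m) → m ℕ.≤ n →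
                     span (fromPairs ps) ℕ.≤ c * lg n
    find-work      : ∀ {n} (M : MultiMap n) y → List.length (pairs M) ℕ.≤ n →
                     work (find M y) ℕ.≤ c * lg n
    find-height    : ∀ {n} (M : MultiMap n) y → List.length (pairs M) ℕ.≤ n →
                     height (run (find M y)) ℕ.≤ c * lg n

------------------------------------------------------------------------
-- The weighted activity selection problem

-- Weights need only be added and compared.
record OrderedMonoid : Set₁ where
  infixl 6 _⊕_
  infix  4 _≤_
  field
    Carrier             : Set
    _≤_                 : Carrier → Carrier → Set
    _⊕_                 : Carrier → Carrier → Carrier
    0#                  : Carrier
    isDecTotalOrder     : IsDecTotalOrder _≡_ _≤_
    isCommutativeMonoid : IsCommutativeMonoid _≡_ _⊕_ 0#
    ⊕-monoʳ-≤           : ∀ x {y z} → y ≤ z → (x ⊕ y) ≤ (x ⊕ z)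

  decTotalOrder : DecTotalOrder 0ℓ 0ℓ 0ℓ
  decTotalOrder = record { isDecTotalOrder = isDecTotalOrder }

  open DecTotalOrder decTotalOrder public using (totalOrder)
  open NaturalMax totalOrder public using () renaming (_⊔_ to _⊔ʷ_)
  open Extrema totalOrder public using (max)

-- b is the maximum of f over the elements satisfying P.
IsMaximum : {A B : Set} → (B → B → Set) → (A → Set) → (A → B) → B → Set
IsMaximum _≤_ P f b = (∃ λ a → P a × f a ≡ b) × (∀ a → P a → f a ≤ b)

module ActivitySelection (time : DecTotalOrder 0ℓ 0ℓ 0ℓ) (weights : OrderedMonoid) where

  private
    module T = DecTotalOrder time
    module W = OrderedMonoid weights
  open PosetProperties T.poset using () renaming (_<_ to _<ᵗ_)

  record Activity : Set where
    field
      start     : T.Carrier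
      end       : T.Carrier
      weight    : W.Carrier
      start<end : start <ᵗ end
  open Activity public

  NonOverlapping : Activity → Activity → Set
  NonOverlapping a b = end b T.≤ start a ⊎ end a T.≤ start b

  SortedByEnd : ∀ {n} → Vec Activity n → Set
  SortedByEnd S = ∀ {i j} → i Fin.≤ j → end (lookup S i) T.≤ end (lookup S j)

  Feasible : ∀ {n} → Vec Activity n → Subset n → Set
  Feasible S U = ∀ {i j} → i ∈ U → j ∈ U → i ≢ j → NonOverlapping (lookup S i) (lookup S j)

  totalWeight : ∀ {n} → Vec Activity n → Subset n → W.Carrier
  totalWeight []      []          = W.0#
  totalWeight (a ∷ S) (true  ∷ U) = weight a W.⊕ totalWeight S U
  totalWeight (_ ∷ S) (false ∷ U) = totalWeight S U

  IsRank : ∀ {n} → Vec Activity n → ℕ → Set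
  IsRank S = IsMaximum ℕ._≤_ (Feasible S) ∣_∣

  IsMaxWeight : ∀ {n} → Vec Activity n → (Subset n → Set) → W.Carrier → Set
  IsMaxWeight S P = IsMaximum W._≤_ P (totalWeight S)

  -- max b xs is the maximum of b and the elements of xs.
  DPRecurrence : ∀ {n} → Vec Activity n → (Fin n → W.Carrier) → Set
  DPRecurrence {n} S dp = ∀ i → dp i ≡
    weight (lookup S i) W.⊕
      W.max W.0# (List.map dp
        (List.filter (λ j → end (lookup S j) T.≤? start (lookup S i)) (List.allFin n)))

  record IsSolution {n} (S : Vec Activity n) (dp : Fin n → W.Carrier) : Set where
    field
      recurrence : DPRecurrence S dp
      prefix     : ∀ i → IsMaxWeight S
                     (λ U → Feasible S U × i ∈ U × (∀ {j} → j ∈ U → j Fin.≤ i)) (dp i)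
      optimum    : IsMaxWeight S (Feasible S) (W.max W.0# (List.tabulate dp))

  ----------------------------------------------------------------------
  -- The Type 2 algorithm

  module Type2 (startTrees : RangeMaxTrees time time)
               (dpTrees    : RangeMaxTrees time W.decTotalOrder)
               (pivotMaps  : MultiMaps) where

    private
      module Start = RangeMaxTrees startTrees
      module DP    = RangeMaxTrees dpTrees
    open MultiMaps pivotMaps using (MultiMap; fromPairs; find)

    module _ {n : ℕ} (S : Vec Activity n) where

      load : Fin n → Comp Activity
      load i = instr (lookup S i)

      findPivot : Start.Tree n → Fin n → Comp (Maybe (Fin n))
      findPivot Tₛ x =
        load x                        >>= λ a →
        Start.rangeMax Tₛ (start a)   >>= λ r →
        instr (Maybe.map proj₁ r)

      pivotPair : Vec (Maybe (Fin n)) n → Fin n → Comp (Rope (Fin n × Fin n))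
      pivotPair pivots x =
        instr (lookup pivots x) >>= λ where
          (just p) → instr (leaf (p , x))
          nothing  → instr empty

      rankOne : Vec (Maybe (Fin n)) n → Fin n → Comp (Rope (Fin n))
      rankOne pivots x =
        instr (lookup pivots x) >>= λ where
          (just _) → instr empty
          nothing  → instr (leaf x)

      dpValue : DP.Tree n → Fin n → Comp (Fin n × W.Carrier)
      dpValue T i =
        load i                                             >>= λ a →
        DP.rangeMax T (start a)                            >>= λ r →
        instr (Maybe.maybe′ (λ m → W.0# W.⊔ʷ proj₂ m) W.0# r) >>= λ m →
        instr (weight a W.⊕ m)                             >>= λ d →
        instr (i , d)

      -- The first argument bounds the number of emptiness tests of the
      -- frontier; the result is nothing if they all fail.
      rounds : ℕ → MultiMap n → Array (Fin n) → DP.Tree n → Comp (Maybe (DP.Tree n))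
      rounds zero    _  _                  T = ret nothing
      rounds (suc k) Tₚ (zero      , _)    T = instr (just T)
      rounds (suc k) Tₚ (m@(suc _) , F)    T = tick (
        parFor m (λ i → instr (lookup F i) >>= dpValue T)    >>= λ us →
        DP.update T us                                       >>= λ T′ →
        collect m (λ i → instr (lookup F i) >>= find Tₚ)     >>= λ F′ →
        rounds k Tₚ F′ T′)

      type2 : Comp (Maybe (DP.Tree n))
      type2 =
        parFor n (λ i → load i >>= λ a → instr (end a , just (start a))) >>= λ es →
        Start.build es                                                   >>= λ Tₛ →
        parFor n (findPivot Tₛ)                                          >>= λ pivots →
        collect n (pivotPair pivots)                                     >>= λ ps →
        fromPairs (proj₂ ps)                                             >>= λ Tₚ →
        parFor n (λ i → load i >>= λ a → instr (end a , nothing))        >>= λ es′ →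
        DP.build es′                                                     >>= λ T →
        collect n (rankOne pivots)                                       >>= λ F →
        rounds (suc n) Tₚ F T

    -- The frontier became empty and the final tree holds the value dp i
    -- at every entry i.
    Computes : ∀ {n} → Vec Activity n → (Fin n → W.Carrier) → Set
    Computes S dp = ∃ λ T → run (type2 S) ≡ just T × (∀ i → proj₂ (DP.entry T i) ≡ just (dp i))

{-# OPTIONS --safe #-}
-- Call the number of iterated pivots of an activity its depth.  The pivot
-- of x has the latest start among the activities that end by the start of
-- x, and the depth is monotone in the start time, so all of these have
-- smaller depth than x.  Hence the frontier of round d consists of the
-- activities of depth d, each reached once through its only pivot, and
-- every DP value queried in that round is already present.  The pivots
-- of x, iterated, form a feasible set together with x, so there are at
-- most rank(S) non-empty rounds, of span O(log n) each.  Every activity is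
-- in exactly one frontier, so all rounds together take O(n log n) work.

module Submission where

open import Defs
open import Level using (0ℓ)
open import Algebra.Structures using (IsCommutativeMonoid)
import Algebra.Construct.NaturalChoice.Max as NaturalMax
open import Data.Bool using (true; false)
open import Data.Empty using (⊥-elim)
open import Data.Fin as Fin using (Fin; zero; suc; toℕ; _↑ˡ_; _↑ʳ_; splitAt)
import Data.Fin.Induction as Fin
import Data.Fin.Properties as Fin
open import Data.Fin.Subset using (Subset; _∈_; _∉_; ∣_∣; ⊥)
open import Data.Fin.Subset.Properties using (∉⊥; ∣⊥∣≡0; ∣p∣≤n)
open import Data.List as List using (List; []; _∷_)
import Data.List.Extrema as Extrema
open import Data.List.Membership.Propositional using () renaming (_∈_ to _∈ˡ_)
open import Data.List.Membership.Propositional.Properties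
  using (∈-lookup; ∈-map⁺; ∈-map⁻; ∈-filter⁺; ∈-filter⁻; ∈-allFin; ∈-tabulate⁺; ∈-tabulate⁻;
         ∈-concat⁺′; ∈-concat⁻′; ∈-++⁻)
import Data.List.Membership.Setoid.Properties as Membershipₛ
import Data.List.Properties as List
open import Data.List.Relation.Binary.Permutation.Propositional using (_↭_; ↭-sym; ↭⇒↭ₛ)
open import Data.List.Relation.Binary.Permutation.Propositional.Properties using (∈-resp-↭; ↭-length)
  renaming (map⁺ to ↭-map⁺)
import Data.List.Relation.Binary.Permutation.Setoid.Properties as Permutationₛ
import Data.List.Relation.Unary.All as All
import Data.List.Relation.Unary.All.Properties as All
import Data.List.Relation.Unary.AllPairs as AllPairs
import Data.List.Relation.Unary.AllPairs.Properties as AllPairs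
open import Data.List.Relation.Unary.Any as Any using (here; there)
open import Data.List.Relation.Unary.Unique.Propositional using () renaming (Unique to Uniqueˡ)
import Data.List.Relation.Unary.Unique.Propositional.Properties as Unique
open import Data.Maybe as Maybe using (Maybe; just; nothing)
open import Data.Maybe.Properties using (just-injective)
open import Data.Nat as ℕ using (ℕ; zero; suc; z≤n; s≤s; _+_; _*_; _⊔_; _≤_; _<_; ⌊_/2⌋; ⌈_/2⌉)
open import Data.Nat.Induction using (<-wellFounded)
open import Data.Nat.Logarithm using (⌊log₂_⌋; ⌈log₂_⌉; ⌊log₂⌋-mono-≤; ⌈log₂⌉-mono-≤)
open import Data.Nat.Logarithm.Core using (⌈log2⌉-acc-irrelevant; ⌊log2⌋-acc-irrelevant)
import Data.Nat.Properties as ℕ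
open import Data.Nat.Tactic.RingSolver using (solve-∀)
open import Data.Product using (∃; _×_; _,_; proj₁; proj₂)
open import Data.Sum using (_⊎_; inj₁; inj₂; [_,_]′)
open import Data.Vec as Vec using (Vec; lookup; []; _∷_; _[_]≔_; here; there)
open import Data.Vec.Membership.Propositional using () renaming (_∈_ to _∈ᵛ_)
import Data.Vec.Membership.Propositional.Properties as Vec
import Data.Vec.Properties as Vec
import Data.Vec.Relation.Unary.All.Properties as VecAll
import Data.Vec.Relation.Unary.AllPairs as VecAllPairs
open import Data.Vec.Relation.Unary.Unique.Propositional using () renaming (Unique to Uniqueᵛ)
import Data.Vec.Relation.Unary.Unique.Propositional.Properties as VecUnique
open import Function using (_∘_; id)
open import Induction.WellFounded using (Acc; acc)
open import Relation.Binary.Bundles using (DecTotalOrder)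
open import Relation.Binary.PropositionalEquality
open import Relation.Nullary using (¬_; yes; no; contradiction)

-- The values `dp` and the depths are fixed before any run is considered, by recursion on indices:
-- the activities are sorted by end time, so whatever ends by the start of `i` has an index below
-- `i`. That `dp` solves the problem is then a fact about the recurrence alone, and a run only has
-- to be shown to reproduce it. Rounds are indexed by depth because following pivots is what the
-- algorithm does; the rank enters as a strict upper bound on depths. The work of a round is charged
-- to the current frontier and to the next one, since the latter is copied into an array within the
-- same round. This is why the rounds are summed by a telescoping potential and not by frontier
-- sizes alone. Copying reads the leaves of a rope at the price of its height, so heights are
-- tracked along with costs. All bounds are first obtained in units of `lg n`, which is positive,
-- and converted to ⌊log₂ n⌋ at the end, where n is at least 2.

-- Values and costs of sequential composition

run->>= : ∀ {A B : Set} (p : Comp A) (f : A → Comp B) → run (p >>= f) ≡ run (f (run p))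
run->>= (ret a)      f = refl
run->>= (tick p)     f = run->>= p f
run->>= (fork p q k) f = run->>= (k (run p) (run q)) f

work->>= : ∀ {A B : Set} (p : Comp A) (f : A → Comp B) → work (p >>= f) ≡ work p + work (f (run p))
work->>= (ret a)      f = refl
work->>= (tick p)     f = cong suc (work->>= p f)
work->>= (fork p q k) f = trans (cong (suc (work p + work q) +_) (work->>= (k (run p) (run q)) f))
  (sym (ℕ.+-assoc (suc (work p + work q)) _ _))

span->>= : ∀ {A B : Set} (p : Comp A) (f : A → Comp B) → span (p >>= f) ≡ span p + span (f (run p))
span->>= (ret a)      f = refl
span->>= (tick p)     f = cong suc (span->>= p f)
span->>= (fork p q k) f = trans (cong (suc (span p ⊔ span q) +_) (span->>= (k (run p) (run q)) f))
  (sym (ℕ.+-assoc (suc (span p ⊔ span q)) _ _))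

span≤work : ∀ {A : Set} (p : Comp A) → span p ≤ work p
span≤work (ret _)      = z≤n
span≤work (tick p)     = s≤s (span≤work p)
span≤work (fork p q k) = s≤s (ℕ.+-mono-≤
  (ℕ.≤-trans (ℕ.m⊔n≤m+n (span p) (span q)) (ℕ.+-mono-≤ (span≤work p) (span≤work q)))
  (span≤work (k (run p) (run q))))

-- Binary logarithms

-- The logarithm recurses on an accessibility proof; unfolding it once leaves a proof other than the
-- canonical one, which has to be exchanged.
⌈log₂[2+n]⌉ : ∀ n → ⌈log₂ suc (suc n) ⌉ ≡ suc ⌈log₂ suc ⌈ n /2⌉ ⌉
⌈log₂[2+n]⌉ n = cong suc (⌈log2⌉-acc-irrelevant (suc ⌈ n /2⌉))

⌊log₂[2+n]⌋ : ∀ n → ⌊log₂ suc (suc n) ⌋ ≡ suc ⌊log₂ suc ⌊ n /2⌋ ⌋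
⌊log₂[2+n]⌋ n = cong suc (⌊log2⌋-acc-irrelevant (suc ⌊ n /2⌋))

-- Parallel loops recurse to depth ⌈log₂ m⌉, whereas `lg` is built on ⌊log₂⌋. One unfolding on each
-- side leads to the same half, as ⌈(n + 1) / 2⌉ is 1 + ⌊n / 2⌋.
⌈log₂[1+n]⌉≤1+⌊log₂n⌋ : ∀ n → ⌈log₂ suc n ⌉ ≤ suc ⌊log₂ n ⌋
⌈log₂[1+n]⌉≤1+⌊log₂n⌋ n = go n (<-wellFounded n)
  where
  go : ∀ n → Acc _<_ n → ⌈log₂ suc n ⌉ ≤ suc ⌊log₂ n ⌋
  go 0             _        = z≤n
  go 1             _        = ℕ.≤-refl
  go (suc (suc n)) (acc rs) rewrite ⌈log₂[2+n]⌉ (suc n) | ⌊log₂[2+n]⌋ n =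
    s≤s (go (suc ⌊ n /2⌋) (rs (ℕ.⌊n/2⌋<n (suc n))))

⌈log₂n⌉≤lg : ∀ {m n} → m ≤ n → ⌈log₂ m ⌉ ≤ lg n
⌈log₂n⌉≤lg {n = n} m≤n = ℕ.≤-trans (⌈log₂⌉-mono-≤ (ℕ.m≤n⇒m≤1+n m≤n)) (⌈log₂[1+n]⌉≤1+⌊log₂n⌋ n)

-- Parallel loops

module _ {A : ℕ → Set} {none : A 0} {join : ∀ {k l} → A k → A l → Comp (A (k + l))} where

  -- Values, heights, work and span of loops are all instances. The step case is about an arbitrary
  -- split k + l and thus free of transports; of the halving it keeps that both parts are nonempty
  -- and have a smaller logarithm.
  parReduce-ind :
    (P : ∀ m → (Fin m → Comp (A 1)) → Comp (A m) → Set) →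
    (∀ f → P 0 f (ret none)) →
    (∀ f → P 1 f (f zero)) →
    (∀ {k l} f {p q} → 0 < k → 0 < l →
      suc ⌈log₂ k ⌉ ≤ ⌈log₂ (k + l) ⌉ → suc ⌈log₂ l ⌉ ≤ ⌈log₂ (k + l) ⌉ →
      P k (λ i → f (i ↑ˡ l)) p → P l (λ i → f (k ↑ʳ i)) q →
      P (k + l) f (tick (fork p q λ a b → join a b >>= ret))) →
    ∀ m rs f → P m f (parReduce A none join m rs f)
  parReduce-ind P P₀ P₁ P₊ = go
    where
    -- With the sum replaced by a variable `m`, matching on `refl` removes the transports from the
    -- indices and from the result.
    glue : ∀ {k l m} (eq : k + l ≡ m) f {p q} → 0 < k → 0 < l →
      suc ⌈log₂ k ⌉ ≤ ⌈log₂ m ⌉ → suc ⌈log₂ l ⌉ ≤ ⌈log₂ m ⌉ →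
      P k (λ i → f (subst Fin eq (i ↑ˡ l))) p → P l (λ i → f (subst Fin eq (k ↑ʳ i))) q →
      P m f (tick (fork p q λ a b → join a b >>= λ c → ret (subst A eq c)))
    glue refl = P₊

    go : ∀ m rs f → P m f (parReduce A none join m rs f)
    go zero                _        f = P₀ f
    go (suc zero)          _        f = P₁ f
    go m@(suc (suc m-2)) (acc rs) f =
      glue (ℕ.⌊n/2⌋+⌈n/2⌉≡n m) f (s≤s z≤n) (s≤s z≤n)
        (ℕ.≤-trans (s≤s (⌈log₂⌉-mono-≤ (ℕ.⌊n/2⌋≤⌈n/2⌉ m))) 1+log≤) 1+log≤
        (go ⌊ m /2⌋ (rs (ℕ.⌊n/2⌋<n (suc m-2))) _) (go ⌈ m /2⌉ (rs (ℕ.⌈n/2⌉<n m-2)) _)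
      where
      1+log≤ = ℕ.≤-reflexive (sym (⌈log₂[2+n]⌉ m-2))

  module _ {j} (work-join : ∀ {k l} (a : A k) (b : A l) → work (join a b) ≤ j) where

    -- The summand 2 + j on the left pays for the join of this result with
    -- another one, which makes the bound additive.
    work-parReduce⁺ : ∀ {w} m rs f → 0 < m → (∀ i → work (f i) ≤ w) →
      (2 + j) + work (parReduce A none join m rs f) ≤ m * (w + (2 + j))
    work-parReduce⁺ {w} = parReduce-ind
      (λ m f p → 0 < m → (∀ i → work (f i) ≤ w) → (2 + j) + work p ≤ m * (w + (2 + j)))
      (λ _ ())
      (λ f _ f≤w → ℕ.≤-trans (ℕ.+-monoʳ-≤ (2 + j) (f≤w zero))
        (ℕ.≤-reflexive (trans (ℕ.+-comm (2 + j) w) (sym (ℕ.*-identityˡ _)))))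
      (λ {k} {l} f {p} {q} 0<k 0<l _ _ p≤ q≤ _ f≤w → begin
        (2 + j) + (1 + (1 + (work p + work q) + work (join (run p) (run q) >>= ret)))
          ≡⟨ cong (λ x → (2 + j) + (1 + (1 + (work p + work q) + x)))
               (trans (work->>= (join (run p) (run q)) ret) (ℕ.+-identityʳ _)) ⟩
        (2 + j) + (1 + (1 + (work p + work q) + work (join (run p) (run q))))
          ≤⟨ ℕ.+-monoʳ-≤ (2 + j) (s≤s (ℕ.+-monoʳ-≤ (suc (work p + work q)) (work-join _ _))) ⟩
        (2 + j) + (1 + (1 + (work p + work q) + j))
          ≡⟨ regroup j (work p) (work q) ⟩
        ((2 + j) + work p) + ((2 + j) + work q)
          ≤⟨ ℕ.+-mono-≤ (p≤ 0<k (λ i → f≤w (i ↑ˡ l))) (q≤ 0<l (λ i → f≤w (k ↑ʳ i))) ⟩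
        k * (w + (2 + j)) + l * (w + (2 + j))
          ≡⟨ ℕ.*-distribʳ-+ (w + (2 + j)) k l ⟨
        (k + l) * (w + (2 + j)) ∎)
      where
      open ℕ.≤-Reasoning
      regroup : ∀ j x y → (2 + j) + (1 + (1 + (x + y) + j)) ≡ ((2 + j) + x) + ((2 + j) + y)
      regroup = solve-∀

    work-parReduce : ∀ {w} m rs f → (∀ i → work (f i) ≤ w) →
      work (parReduce A none join m rs f) ≤ m * (w + (2 + j))
    work-parReduce zero      rs f f≤w = z≤n
    work-parReduce m@(suc _) rs f f≤w = ℕ.m+n≤o⇒n≤o (2 + j) (work-parReduce⁺ m rs f (s≤s z≤n) f≤w)

  module _ {j} (span-join : ∀ {k l} (a : A k) (b : A l) → span (join a b) ≤ j) where

    -- Each of the ⌈log₂ m⌉ levels adds a tick, a fork and one join, together 2 + j; the bodies at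
    -- the leaves run in parallel and add `s` once.
    span-parReduce : ∀ {s} m rs f → (∀ i → span (f i) ≤ s) →
      span (parReduce A none join m rs f) ≤ ⌈log₂ m ⌉ * (2 + j) + s
    span-parReduce {s} = parReduce-ind
      (λ m f p → (∀ i → span (f i) ≤ s) → span p ≤ ⌈log₂ m ⌉ * (2 + j) + s)
      (λ _ _ → z≤n)
      (λ f f≤s → f≤s zero)
      (λ {k} {l} f {p} {q} _ _ k< l< p≤ q≤ f≤s → begin
        1 + (1 + (span p ⊔ span q) + span (join (run p) (run q) >>= ret))
          ≡⟨ cong (λ x → 1 + (1 + (span p ⊔ span q) + x))
               (trans (span->>= (join (run p) (run q)) ret) (ℕ.+-identityʳ _)) ⟩
        1 + (1 + (span p ⊔ span q) + span (join (run p) (run q)))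
          ≤⟨ s≤s (ℕ.+-monoʳ-≤ (suc (span p ⊔ span q)) (span-join _ _)) ⟩
        1 + (1 + (span p ⊔ span q) + j)
          ≡⟨ cong suc (cong suc (ℕ.+-comm (span p ⊔ span q) j)) ⟩
        (2 + j) + (span p ⊔ span q)
          ≤⟨ join≤ (p≤ (λ i → f≤s (i ↑ˡ l))) k< (q≤ (λ i → f≤s (k ↑ʳ i))) l< ⟩
        ⌈log₂ (k + l) ⌉ * (2 + j) + s ∎)
      where
      open ℕ.≤-Reasoning
      half : ∀ {x a b} → x ≤ a * (2 + j) + s → suc a ≤ b → (2 + j) + x ≤ b * (2 + j) + s
      half {x} {a} {b} x≤ a<b = begin
        (2 + j) + x                   ≤⟨ ℕ.+-monoʳ-≤ (2 + j) x≤ ⟩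
        (2 + j) + (a * (2 + j) + s)   ≡⟨ ℕ.+-assoc (2 + j) (a * (2 + j)) s ⟨
        suc a * (2 + j) + s           ≤⟨ ℕ.+-monoˡ-≤ s (ℕ.*-monoˡ-≤ (2 + j) a<b) ⟩
        b * (2 + j) + s               ∎
      join≤ : ∀ {x y a a′ b} → x ≤ a * (2 + j) + s → suc a ≤ b →
        y ≤ a′ * (2 + j) + s → suc a′ ≤ b → (2 + j) + (x ⊔ y) ≤ b * (2 + j) + s
      join≤ {x} {y} x≤ a<b y≤ a′<b = begin
        (2 + j) + (x ⊔ y)           ≡⟨ ℕ.+-distribˡ-⊔ (2 + j) x y ⟩
        (2 + j + x) ⊔ (2 + j + y)   ≤⟨ ℕ.⊔-lub (half x≤ a<b) (half y≤ a′<b) ⟩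
        _                           ∎

lookup-parFor : ∀ {B : Set} m (f : Fin m → Comp B) i → lookup (run (parFor m f)) i ≡ run (f i)
lookup-parFor {B} m f i = trans
  (parReduce-ind {A = Vec B}
    -- A loop body returns a slice of one cell, and `Vec.head` reads that cell.
    (λ m g p → ∀ i → lookup (run p) i ≡ Vec.head (run (g i)))
    (λ _ ())
    (λ g → λ { zero → lookup-zero (run (g zero)) })
    (λ {k} {l} g {p} {q} _ _ _ _ p≡ q≡ i → trans (Vec.lookup-splitAt k (run p) (run q) i) (side g {run p} {run q} p≡ q≡ i))
    m (<-wellFounded m) _ i)
  (cong Vec.head (run->>= (f i) (λ b → instr (b ∷ []))))
  where
  lookup-zero : (v : Vec B 1) → lookup v zero ≡ Vec.head v
  lookup-zero (_ ∷ _) = refl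

  side : ∀ {k l} (g : Fin (k + l) → Comp (Vec B 1)) {u : Vec B k} {v : Vec B l} →
    (∀ i → lookup u i ≡ Vec.head (run (g (i ↑ˡ l)))) →
    (∀ i → lookup v i ≡ Vec.head (run (g (k ↑ʳ i)))) →
    ∀ i → [ lookup u , lookup v ]′ (splitAt k i) ≡ Vec.head (run (g i))
  side {k} {l} g u≡ v≡ i with splitAt k i in eq
  ... | inj₁ i′ = trans (u≡ i′) (cong (Vec.head ∘ run ∘ g) (Fin.splitAt⁻¹-↑ˡ eq))
  ... | inj₂ i′ = trans (v≡ i′) (cong (Vec.head ∘ run ∘ g) (Fin.splitAt⁻¹-↑ʳ eq))

-- The first phase of `collect`, before the rope is copied into an array.
parRope : {B : Set} (m : ℕ) → (Fin m → Comp (Rope B)) → Comp (Rope B)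
parRope {B} m = parReduce (λ _ → Rope B) empty (λ l r → instr (node l r)) m (<-wellFounded m)

tabulate-+ : ∀ {A : Set} k {l} (f : Fin (k + l) → A) →
  List.tabulate f ≡ List.tabulate (λ i → f (i ↑ˡ l)) List.++ List.tabulate (λ i → f (k ↑ʳ i))
tabulate-+ zero    f = refl
tabulate-+ (suc k) f = cong (f zero ∷_) (tabulate-+ k (f ∘ suc))

module _ {B : Set} where

  toList-parRope : ∀ m (f : Fin m → Comp (Rope B)) →
    toList (run (parRope m f)) ≡ List.concat (List.tabulate (λ i → toList (run (f i))))
  toList-parRope m = parReduce-ind
    (λ m f p → toList (run p) ≡ List.concat (List.tabulate (λ i → toList (run (f i)))))
    (λ _ → refl)
    (λ f → sym (List.++-identityʳ _))
    (λ {k} {l} f _ _ _ _ p≡ q≡ → trans (cong₂ List._++_ p≡ q≡)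
      (trans (List.concat-++ (List.tabulate (λ i → toList (run (f (i ↑ˡ l)))))
                                (List.tabulate (λ i → toList (run (f (k ↑ʳ i))))))
             (cong List.concat (sym (tabulate-+ k (λ i → toList (run (f i))))))))
    m (<-wellFounded m)

  -- Halving places ⌈log₂ m⌉ levels of nodes above the ropes of the bodies. The height matters
  -- because it is the cost of reading one leaf.
  height-parRope : ∀ {h} m (f : Fin m → Comp (Rope B)) → (∀ i → height (run (f i)) ≤ h) →
    height (run (parRope m f)) ≤ ⌈log₂ m ⌉ + h
  height-parRope {h} m = parReduce-ind
    (λ m f p → (∀ i → height (run (f i)) ≤ h) → height (run p) ≤ ⌈log₂ m ⌉ + h)
    (λ _ _ → z≤n)
    (λ f f≤h → f≤h zero)
    (λ {k} {l} f {p} {q} _ _ k< l< p≤ q≤ f≤h → ℕ.⊔-lub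
      (ℕ.≤-trans (s≤s (p≤ (λ i → f≤h (i ↑ˡ l)))) (ℕ.+-monoˡ-≤ h k<))
      (ℕ.≤-trans (s≤s (q≤ (λ i → f≤h (k ↑ʳ i)))) (ℕ.+-monoˡ-≤ h l<)))
    m (<-wellFounded m)

  work-nth : ∀ (r : Rope B) i → work (nth r i) ≤ suc (height r)
  work-nth (leaf b)   _ = ℕ.≤-refl
  work-nth (node l r) i with splitAt (size l) i
  ... | inj₁ j = s≤s (ℕ.≤-trans (work-nth l j) (s≤s (ℕ.m≤m⊔n _ _)))
  ... | inj₂ j = s≤s (ℕ.≤-trans (work-nth r j) (s≤s (ℕ.m≤n⊔m (height l) _)))

  tabulate-nth : ∀ (r : Rope B) → List.tabulate (λ i → run (nth r i)) ≡ toList r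
  tabulate-nth empty      = refl
  tabulate-nth (leaf b)   = refl
  tabulate-nth (node l r) = trans (tabulate-+ (size l) _) (cong₂ List._++_
    (trans (List.tabulate-cong (λ i → cong (run ∘ [ nth l , nth r ]′) (Fin.splitAt-↑ˡ (size l) i (size r))))
           (tabulate-nth l))
    (trans (List.tabulate-cong (λ i → cong (run ∘ [ nth l , nth r ]′) (Fin.splitAt-↑ʳ (size l) (size r) i)))
           (tabulate-nth r)))

toList-tabulate-lookup : ∀ {B : Set} {m} (v : Vec B m) → Vec.toList v ≡ List.tabulate (lookup v)
toList-tabulate-lookup []      = refl
toList-tabulate-lookup (b ∷ v) = cong (b ∷_) (toList-tabulate-lookup v)

toList-parFor : ∀ {B : Set} m (f : Fin m → Comp B) →
  Vec.toList (run (parFor m f)) ≡ List.tabulate (λ i → run (f i))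
toList-parFor m f = trans (toList-tabulate-lookup _) (List.tabulate-cong (lookup-parFor m f))

module _ {B : Set} (m : ℕ) (f : Fin m → Comp (Rope B)) where

  private
    r = run (parRope m f)

  run-collect : run (collect m f) ≡ (size r , run (parFor (size r) (nth r)))
  run-collect = trans (run->>= (parRope m f) _) (run->>= (parFor (size r) (nth r)) _)

  toList-collect : Vec.toList (proj₂ (run (collect m f))) ≡
    List.concat (List.tabulate (λ i → toList (run (f i))))
  toList-collect = trans (cong (Vec.toList ∘ proj₂) run-collect)
    (trans (toList-parFor (size r) (nth r)) (trans (tabulate-nth r) (toList-parRope m f)))

-- One constant bounds both the work (in units of X) and the span (in units
-- of Y), so that sequencing adds constants.
record Costs {A : Set} (X Y a : ℕ) (p : Comp A) : Set where
  constructor _,_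
  field
    work≤ : work p ≤ a * X
    span≤ : span p ≤ a * Y
open Costs public

module _ {X Y : ℕ} where

  infixl 1 _>>=ᶜ_
  _>>=ᶜ_ : ∀ {A B : Set} {a b} {p : Comp A} {f : A → Comp B} →
    Costs X Y a p → Costs X Y b (f (run p)) → Costs X Y (a + b) (p >>= f)
  _>>=ᶜ_ {a = a} {b} {p} {f} (pw , ps) (fw , fs) =
    ℕ.≤-trans (ℕ.≤-reflexive (work->>= p f)) (ℕ.≤-trans (ℕ.+-mono-≤ pw fw) (ℕ.≤-reflexive (sym (ℕ.*-distribʳ-+ X a b)))) ,
    ℕ.≤-trans (ℕ.≤-reflexive (span->>= p f)) (ℕ.≤-trans (ℕ.+-mono-≤ ps fs) (ℕ.≤-reflexive (sym (ℕ.*-distribʳ-+ Y a b))))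

  Costs-mono : ∀ {A : Set} {X′ Y′ a a′} {p : Comp A} → X ≤ X′ → Y ≤ Y′ → a ≤ a′ → Costs X Y a p → Costs X′ Y′ a′ p
  Costs-mono X≤ Y≤ a≤ (pw , ps) = ℕ.≤-trans pw (ℕ.*-mono-≤ a≤ X≤) , ℕ.≤-trans ps (ℕ.*-mono-≤ a≤ Y≤)

  Costs-ret : ∀ {A : Set} {x : A} → Costs X Y 0 (ret x)
  Costs-ret = z≤n , z≤n

  module _ (0<X : 0 < X) (0<Y : 0 < Y) where

    Costs-tick : ∀ {A : Set} {a} {p : Comp A} → Costs X Y a p → Costs X Y (suc a) (tick p)
    Costs-tick (pw , ps) = ℕ.+-mono-≤ 0<X pw , ℕ.+-mono-≤ 0<Y ps

    Costs-instr : ∀ {A : Set} {x : A} → Costs X Y 1 (instr x)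
    Costs-instr = Costs-tick Costs-ret

-- Tree queries come with a bound on work only; as span never exceeds work, it serves for both.
sequential : ∀ {ℓ a} {A : Set} {p : Comp A} → work p ≤ a * ℓ → Costs ℓ ℓ a p
sequential {p = p} w = w , ℕ.≤-trans (span≤work p) w

-- Costs of parallel loops

module _ {ℓ : ℕ} (0<ℓ : 0 < ℓ) where

  m≤m*ℓ : ∀ m → m ≤ m * ℓ
  m≤m*ℓ m = ℕ.≤-trans (ℕ.≤-reflexive (sym (ℕ.*-identityʳ m))) (ℕ.*-monoʳ-≤ m 0<ℓ)

  -- A unit of N * ℓ with N above m also pays for the overhead of an empty loop, and lets loops of
  -- different sizes share one unit. The 4 is dictated by the span: allocation, store, and two
  -- instructions on each of at most ℓ levels.
  parFor-Costs : ∀ {B : Set} {a m N} {f : Fin m → Comp B} → ⌈log₂ m ⌉ ≤ ℓ → m < N →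
    (∀ i → Costs ℓ ℓ a (f i)) → Costs (N * ℓ) ℓ (a + 4) (parFor m f)
  parFor-Costs {B} {a} {m} {N} {f} log≤ m<N f≤ = Costs-mono (ℕ.*-monoˡ-≤ ℓ m<N) ℕ.≤-refl ℕ.≤-refl
    ( (begin
        1 + work (parReduce _ _ _ m _ _)
          ≤⟨ s≤s (work-parReduce (λ _ _ → z≤n) m _ _ (λ i → subst (_≤ suc (a * ℓ)) (sym (work-store i)) (s≤s (work≤ (f≤ i))))) ⟩
        1 + m * (suc (a * ℓ) + 2)
          ≡⟨ e₁ m (a * ℓ) ⟩
        m * (a * ℓ) + (1 + m * 3)
          ≤⟨ ℕ.+-monoʳ-≤ (m * (a * ℓ)) (m≤m*ℓ (1 + m * 3)) ⟩
        m * (a * ℓ) + (1 + m * 3) * ℓ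
          ≤⟨ ℕ.m≤m+n _ (a * ℓ + (m * ℓ + 3 * ℓ)) ⟩
        m * (a * ℓ) + (1 + m * 3) * ℓ + (a * ℓ + (m * ℓ + 3 * ℓ))
          ≡⟨ e₂ a m ℓ ⟩
        (a + 4) * (suc m * ℓ) ∎)
    , (begin
        1 + span (parReduce _ _ _ m _ _)
          ≤⟨ s≤s (span-parReduce (λ _ _ → z≤n) m _ _ (λ i → subst (_≤ suc (a * ℓ)) (sym (span-store i)) (s≤s (span≤ (f≤ i))))) ⟩
        1 + (⌈log₂ m ⌉ * 2 + suc (a * ℓ))
          ≤⟨ s≤s (ℕ.+-monoˡ-≤ (suc (a * ℓ)) (ℕ.*-monoˡ-≤ 2 log≤)) ⟩
        1 + (ℓ * 2 + suc (a * ℓ))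
          ≡⟨ e₃ (a * ℓ) ℓ ⟩
        2 + (a * ℓ + ℓ * 2)
          ≤⟨ ℕ.+-monoˡ-≤ (a * ℓ + ℓ * 2) (m≤m*ℓ 2) ⟩
        2 * ℓ + (a * ℓ + ℓ * 2)
          ≡⟨ e₄ a ℓ ⟩
        (a + 4) * ℓ ∎))
    where
    open ℕ.≤-Reasoning
    work-store : ∀ i → work (f i >>= λ b → instr (b ∷ [])) ≡ suc (work (f i))
    work-store i = trans (work->>= (f i) _) (ℕ.+-comm _ 1)
    span-store : ∀ i → span (f i >>= λ b → instr (b ∷ [])) ≡ suc (span (f i))
    span-store i = trans (span->>= (f i) _) (ℕ.+-comm _ 1)
    e₁ : ∀ m x → 1 + m * (suc x + 2) ≡ m * x + (1 + m * 3)
    e₁ = solve-∀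
    e₂ : ∀ a m ℓ → m * (a * ℓ) + (1 + m * 3) * ℓ + (a * ℓ + (m * ℓ + 3 * ℓ)) ≡ (a + 4) * (suc m * ℓ)
    e₂ = solve-∀
    e₃ : ∀ x ℓ → 1 + (ℓ * 2 + suc x) ≡ 2 + (x + ℓ * 2)
    e₃ = solve-∀
    e₄ : ∀ a ℓ → 2 * ℓ + (a * ℓ + ℓ * 2) ≡ (a + 4) * ℓ
    e₄ = solve-∀

  -- The 3 is the tick, the fork and the allocated rope node of each join.
  parRope-Costs : ∀ {B : Set} {a m N} {f : Fin m → Comp (Rope B)} → ⌈log₂ m ⌉ ≤ ℓ → m < N →
    (∀ i → Costs ℓ ℓ a (f i)) → Costs (N * ℓ) ℓ (a + 3) (parRope m f)
  parRope-Costs {B} {a} {m} {N} {f} log≤ m<N f≤ = Costs-mono (ℕ.*-monoˡ-≤ ℓ m<N) ℕ.≤-refl ℕ.≤-refl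
    ( (begin
        work (parRope m f)
          ≤⟨ work-parReduce (λ _ _ → ℕ.≤-refl) m _ f (λ i → work≤ (f≤ i)) ⟩
        m * (a * ℓ + 3)
          ≤⟨ ℕ.*-monoʳ-≤ m (ℕ.+-monoʳ-≤ (a * ℓ) (m≤m*ℓ 3)) ⟩
        m * (a * ℓ + 3 * ℓ)
          ≤⟨ ℕ.m≤n+m _ (a * ℓ + 3 * ℓ) ⟩
        suc m * (a * ℓ + 3 * ℓ)
          ≡⟨ e₁ a m ℓ ⟩
        (a + 3) * (suc m * ℓ) ∎)
    , (begin
        span (parRope m f)
          ≤⟨ span-parReduce (λ _ _ → ℕ.≤-refl) m _ f (λ i → span≤ (f≤ i)) ⟩
        ⌈log₂ m ⌉ * 3 + a * ℓ
          ≤⟨ ℕ.+-monoˡ-≤ (a * ℓ) (ℕ.*-monoˡ-≤ 3 log≤) ⟩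
        ℓ * 3 + a * ℓ
          ≡⟨ e₂ a ℓ ⟩
        (a + 3) * ℓ ∎))
    where
    open ℕ.≤-Reasoning
    e₁ : ∀ a m ℓ → suc m * (a * ℓ + 3 * ℓ) ≡ (a + 3) * (suc m * ℓ)
    e₁ = solve-∀
    e₂ : ∀ a ℓ → ℓ * 3 + a * ℓ ≡ (a + 3) * ℓ
    e₂ = solve-∀

  -- The copying loop ranges over the output, so `N` has to exceed the sizes of input and output.
  -- Building the rope contributes a + 3, one instruction follows, and copying contributes (a + 2) +
  -- 4, where a + 2 bounds the path to a leaf.
  collect-Costs : ∀ {B : Set} {a m N} {f : Fin m → Comp (Rope B)} →
    let m′ = proj₁ (run (collect m f)) in
    ⌈log₂ m ⌉ ≤ ℓ → ⌈log₂ m′ ⌉ ≤ ℓ → m < N → m′ < N →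
    (∀ i → Costs ℓ ℓ a (f i)) → (∀ i → height (run (f i)) ≤ a * ℓ) →
    Costs (N * ℓ) ℓ (2 * a + 10) (collect m f)
  collect-Costs {B} {a} {m} {N} {f} log≤ log≤′ m<N m′<N f≤ h≤ = Costs-mono ℕ.≤-refl ℕ.≤-refl (ℕ.≤-reflexive (e a))
    (parRope-Costs log≤ m<N f≤ >>=ᶜ
     Costs-tick 0<Nℓ 0<ℓ
       (parFor-Costs (subst (λ x → ⌈log₂ x ⌉ ≤ ℓ) size≡ log≤′) (subst (_< N) size≡ m′<N) nth≤ >>=ᶜ
        Costs-ret))
    where
    0<Nℓ = ℕ.*-mono-< (ℕ.≤-trans (s≤s z≤n) m<N) 0<ℓ
    r = run (parRope m f)
    size≡ = cong proj₁ (run-collect m f)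
    nth≤ : ∀ i → Costs ℓ ℓ (a + 2) (nth r i)
    nth≤ i = sequential (begin
      work (nth r i)         ≤⟨ work-nth r i ⟩
      suc (height r)         ≤⟨ ℕ.+-mono-≤ 0<ℓ (height-parRope m f h≤) ⟩
      ℓ + (⌈log₂ m ⌉ + a * ℓ)  ≤⟨ ℕ.+-monoʳ-≤ ℓ (ℕ.+-monoˡ-≤ (a * ℓ) log≤) ⟩
      ℓ + (ℓ + a * ℓ)        ≡⟨ e′ a ℓ ⟩
      (a + 2) * ℓ            ∎)
      where
      open ℕ.≤-Reasoning
      e′ : ∀ a ℓ → ℓ + (ℓ + a * ℓ) ≡ (a + 2) * ℓ
      e′ = solve-∀
    e : ∀ a → (a + 3) + (1 + ((a + 2 + 4) + 0)) ≡ 2 * a + 10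
    e = solve-∀

-- Lists without repetition and recursion on indices

module _ {A : Set} where

  Unique⇒lookup-injective : ∀ {xs : List A} → Uniqueˡ xs →
    ∀ {i j} → List.lookup xs i ≡ List.lookup xs j → i ≡ j
  Unique⇒lookup-injective (_ AllPairs.∷ _)  {zero}  {zero}  _  = refl
  Unique⇒lookup-injective (x∉ AllPairs.∷ _) {zero}  {suc j} eq =
    contradiction eq (All.lookup x∉ (∈-lookup j))
  Unique⇒lookup-injective (x∉ AllPairs.∷ _) {suc i} {zero}  eq =
    contradiction (sym eq) (All.lookup x∉ (∈-lookup i))
  Unique⇒lookup-injective (_ AllPairs.∷ u)  {suc i} {suc j} eq =
    cong suc (Unique⇒lookup-injective u eq)

  -- Sending each position in `xs` to a position of the same element in `ys` is injective.
  Unique-⊆⇒length≤ : ∀ {xs ys : List A} → Uniqueˡ xs →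
    (∀ {x} → x ∈ˡ xs → x ∈ˡ ys) → List.length xs ℕ.≤ List.length ys
  Unique-⊆⇒length≤ {xs} u sub = Fin.injective⇒≤ {f = λ i → Any.index (sub (∈-lookup {xs = xs} i))}
    (λ eq → Unique⇒lookup-injective u
      (Membershipₛ.index-injective (setoid A) (sub (∈-lookup _)) (sub (∈-lookup _)) eq))

-- Course-of-values recursion by iteration: as `F` reads smaller indices only, the value at `i` is
-- settled after i + 1 iterations, and n iterations settle all. No accessibility proof occurs in the
-- values, so unfolding is a plain equation.
module LocalFixpoint {A : Set} {n : ℕ} (default : A) (F : (Fin n → A) → Fin n → A)
  (local : ∀ {g h i} → (∀ {j} → j Fin.< i → g j ≡ h j) → F g i ≡ F h i) where

  private
    iterate : ℕ → Fin n → A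
    iterate zero    = λ _ → default
    iterate (suc k) = F (iterate k)

    iterate-stable : ∀ k l {i} → toℕ i ℕ.< k → toℕ i ℕ.< l → iterate k i ≡ iterate l i
    iterate-stable (suc k) (suc l) (s≤s i≤k) (s≤s i≤l) =
      local λ j<i → iterate-stable k l (ℕ.<-≤-trans j<i i≤k) (ℕ.<-≤-trans j<i i≤l)

  fix : Fin n → A
  fix = iterate n

  fix-unfold : ∀ i → fix i ≡ F fix i
  fix-unfold i = iterate-stable n (suc n) (Fin.toℕ<n i) (ℕ.m<n⇒m<1+n (Fin.toℕ<n i))

-- Subsets and feasible sets

-- Upper bounds on the weight of a feasible set peel off its last activity, which this provides.
toMax : ∀ {n} (U : Subset n) → (∀ j → j ∉ U) ⊎ (∃ λ j → j ∈ U × (∀ {k} → k ∈ U → k Fin.≤ j))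
toMax []      = inj₁ λ ()
toMax (b ∷ U) with toMax U
toMax (b     ∷ U) | inj₂ (j , j∈U , max) = inj₂ (suc j , there j∈U , λ where
  here       → z≤n
  (there k∈) → s≤s (max k∈))
toMax (true  ∷ U) | inj₁ ∉U = inj₂ (zero , here , λ where
  here           → z≤n
  (there {i = k} k∈) → ⊥-elim (∉U k k∈))
toMax (false ∷ U) | inj₁ ∉U = inj₁ λ where
  (suc j) (there j∈) → ∉U j j∈

∉⇒outside : ∀ {n} {U : Subset n} {i} → i ∉ U → lookup U i ≡ false
∉⇒outside {U = U} {i} i∉ with lookup U i in eq
... | false = refl
... | true  = ⊥-elim (i∉ (Vec.lookup⇒[]= i U eq))

∈-[]≔-other : ∀ {n} {U : Subset n} {i k b} → k ≢ i → k ∈ (U [ i ]≔ b) → k ∈ U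
∈-[]≔-other {U = U} {i} {k} k≢i k∈ =
  Vec.lookup⇒[]= k U (trans (sym (Vec.lookup∘update′ k≢i U _)) (Vec.[]=⇒lookup k∈))

∉-[]≔-outside : ∀ {n} {U : Subset n} {i} → i ∉ (U [ i ]≔ false)
∉-[]≔-outside {U = U} {i} i∈ with () ← trans (sym (Vec.lookup∘update i U false)) (Vec.[]=⇒lookup i∈)

[]≔-restore : ∀ {n} {U : Subset n} {i} → i ∈ U → (U [ i ]≔ false) [ i ]≔ true ≡ U
[]≔-restore {U = U} {i} i∈U = trans (Vec.[]≔-idempotent U i)
  (trans (cong (U [ i ]≔_) (sym (Vec.[]=⇒lookup i∈U))) (Vec.[]≔-lookup U i))

∣insert∣ : ∀ {n} (U : Subset n) i → lookup U i ≡ false → ∣ U [ i ]≔ true ∣ ≡ suc ∣ U ∣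
∣insert∣ (false ∷ U) zero    _  = refl
∣insert∣ (true  ∷ U) (suc i) eq = cong suc (∣insert∣ U i eq)
∣insert∣ (false ∷ U) (suc i) eq = ∣insert∣ U i eq

-- Maxima of weights

module _ (weights : OrderedMonoid) where
  private
    module W = OrderedMonoid weights
    module WO = DecTotalOrder W.decTotalOrder
  open Extrema W.totalOrder using (argmax-sel; ⊥≤max; xs≤max; max≤v⁺)

  max-characterisation : ∀ {b xs v} → b W.≤ v → (∀ {x} → x ∈ˡ xs → x W.≤ v) →
    v ≡ b ⊎ v ∈ˡ xs → v ≡ W.max b xs
  max-characterisation {b} {xs} b≤v xs≤v sel = WO.antisym (lower sel) (max≤v⁺ b≤v (All.tabulate xs≤v))
    where
    lower : _ → _
    lower (inj₁ refl) = ⊥≤max b xs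
    lower (inj₂ v∈)   = All.lookup (xs≤max b xs) v∈

  max-sel : ∀ b xs → W.max b xs ≡ b ⊎ W.max b xs ∈ˡ xs
  max-sel = argmax-sel id

-- Feasible sets of sorted activities and the recurrence

module _ (time : DecTotalOrder 0ℓ 0ℓ 0ℓ) (weights : OrderedMonoid) where
  private
    module T = DecTotalOrder time
    module W = OrderedMonoid weights
    module WO = DecTotalOrder W.decTotalOrder
    module WM = IsCommutativeMonoid W.isCommutativeMonoid
  open ActivitySelection time weights
  open Extrema W.totalOrder using (⊥≤max; xs≤max)

  ¬end≤start : ∀ a → ¬ (end a T.≤ start a)
  ¬end≤start a e≤s = proj₂ (start<end a) (T.antisym (proj₁ (start<end a)) e≤s)

  totalWeight-insert : ∀ {n} (S : Vec Activity n) U i → lookup U i ≡ false →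
    totalWeight S (U [ i ]≔ true) ≡ weight (lookup S i) W.⊕ totalWeight S U
  totalWeight-insert (a ∷ S) (false ∷ U) zero    _  = refl
  totalWeight-insert (a ∷ S) (false ∷ U) (suc i) eq = totalWeight-insert S U i eq
  totalWeight-insert (a ∷ S) (true  ∷ U) (suc i) eq = begin
    weight a W.⊕ totalWeight S (U [ i ]≔ true)   ≡⟨ cong (weight a W.⊕_) (totalWeight-insert S U i eq) ⟩
    weight a W.⊕ (wᵢ W.⊕ totalWeight S U)        ≡⟨ WM.assoc _ _ _ ⟨
    (weight a W.⊕ wᵢ) W.⊕ totalWeight S U        ≡⟨ cong (W._⊕ totalWeight S U) (WM.comm _ _) ⟩
    (wᵢ W.⊕ weight a) W.⊕ totalWeight S U        ≡⟨ WM.assoc _ _ _ ⟩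
    wᵢ W.⊕ (weight a W.⊕ totalWeight S U)        ∎
    where
    open ≡-Reasoning
    wᵢ = weight (lookup S i)

  totalWeight-empty : ∀ {n} (S : Vec Activity n) U → (∀ j → j ∉ U) → totalWeight S U ≡ W.0#
  totalWeight-empty []      []          _  = refl
  totalWeight-empty (a ∷ S) (true  ∷ U) ∉U = ⊥-elim (∉U zero here)
  totalWeight-empty (a ∷ S) (false ∷ U) ∉U = totalWeight-empty S U λ j j∈ → ∉U (suc j) (there j∈)

  module SortedActivities {n} (S : Vec Activity n) (sorted : SortedByEnd S) where

    infix 4 _⊴_
    _⊴_ : Fin n → Fin n → Set
    j ⊴ i = end (lookup S j) T.≤ start (lookup S i)

    ⊴⇒≱ : ∀ {i j} → j ⊴ i → ¬ (end (lookup S i) T.≤ end (lookup S j))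
    ⊴⇒≱ {i} j⊴i eᵢ≤eⱼ = ¬end≤start (lookup S i) (T.trans eᵢ≤eⱼ j⊴i)

    -- If i ≤ j, sorting would make `i` end by its own start. This is what turns precedence in time
    -- into a well-founded order on indices.
    ⊴⇒< : ∀ {i j} → j ⊴ i → j Fin.< i
    ⊴⇒< j⊴i = ℕ.≰⇒> (⊴⇒≱ j⊴i ∘ sorted)

    <⇒⊴ : ∀ {i j} → NonOverlapping (lookup S i) (lookup S j) → j Fin.< i → j ⊴ i
    <⇒⊴ (inj₁ j⊴i) _   = j⊴i
    <⇒⊴ (inj₂ i⊴j) j<i = contradiction (⊴⇒< i⊴j) (ℕ.<-asym j<i)

    predecessors : Fin n → List (Fin n)
    predecessors i = List.filter (λ j → end (lookup S j) T.≤? start (lookup S i)) (List.allFin n)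

    ∈-predecessors⁺ : ∀ {i j} → j ⊴ i → j ∈ˡ predecessors i
    ∈-predecessors⁺ {i} j⊴i = ∈-filter⁺ (λ j → end (lookup S j) T.≤? start (lookup S i)) (∈-allFin _) j⊴i

    ∈-predecessors⁻ : ∀ {i j} → j ∈ˡ predecessors i → j ⊴ i
    ∈-predecessors⁻ {i} j∈ = proj₂ (∈-filter⁻ (λ j → end (lookup S j) T.≤? start (lookup S i))
      {xs = List.allFin n} j∈)

    FeasibleUpTo : Fin n → Subset n → Set
    FeasibleUpTo i U = Feasible S U × i ∈ U × (∀ {j} → j ∈ U → j Fin.≤ i)

    module _ {U i} (feasible : Feasible S U) (before : ∀ {k} → k ∈ U → k ⊴ i) where

      insert-new : lookup U i ≡ false
      insert-new = ∉⇒outside λ i∈ → ⊴⇒≱ (before i∈) T.refl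

      -- The one construction behind the sets that attain `dp` and the chains of pivots.
      insert-feasibleUpTo : FeasibleUpTo i (U [ i ]≔ true)
      insert-feasibleUpTo = feasible′ , Vec.lookup⇒[]= i _ (Vec.lookup∘update i U true) , upTo
        where
        feasible′ : Feasible S (U [ i ]≔ true)
        feasible′ {j} {k} j∈ k∈ j≢k with j Fin.≟ i | k Fin.≟ i
        ... | yes refl | yes refl = contradiction refl j≢k
        ... | yes refl | no k≢i   = inj₁ (before (∈-[]≔-other k≢i k∈))
        ... | no j≢i   | yes refl = inj₂ (before (∈-[]≔-other j≢i j∈))
        ... | no j≢i   | no k≢i   = feasible (∈-[]≔-other j≢i j∈) (∈-[]≔-other k≢i k∈) j≢k
        upTo : ∀ {j} → j ∈ (U [ i ]≔ true) → j Fin.≤ i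
        upTo {j} j∈ with j Fin.≟ i
        ... | yes refl = ℕ.≤-refl
        ... | no j≢i   = ℕ.<⇒≤ (⊴⇒< (before (∈-[]≔-other j≢i j∈)))

    -- By sorting, no member of `U` ends after `j`.
    before-last : ∀ {U i j} → (∀ {k} → k ∈ U → k Fin.≤ j) → j ⊴ i → ∀ {k} → k ∈ U → k ⊴ i
    before-last upTo j⊴i k∈ = T.trans (sorted (upTo k∈)) j⊴i

    ∅-before : ∀ {i k} → k ∈ ⊥ → k ⊴ i
    ∅-before k∈ = contradiction k∈ ∉⊥

    ∅-feasible : Feasible S ⊥
    ∅-feasible i∈ = contradiction i∈ ∉⊥

    dpStep : (Fin n → W.Carrier) → Fin n → W.Carrier
    dpStep g i = weight (lookup S i) W.⊕ W.max W.0# (List.map g (predecessors i))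

    open LocalFixpoint W.0# dpStep (λ {_} {_} {i} g≡h → cong (λ ws → weight (lookup S i) W.⊕ W.max W.0# ws)
      (List.map-cong-local (All.tabulate λ j∈ → g≡h (⊴⇒< (∈-predecessors⁻ j∈)))))
      public renaming (fix to dp; fix-unfold to dp-recurrence)

    dpMax : Fin n → W.Carrier
    dpMax i = W.max W.0# (List.map dp (predecessors i))

    -- If the maximum in the recurrence is 0, `i` alone attains it; otherwise it is `dp j` for a
    -- predecessor `j`, and `i` is added to a set attaining that.
    dp-attained : ∀ i → ∃ λ U → FeasibleUpTo i U × totalWeight S U ≡ dp i
    dp-attained i = go i (Fin.<-wellFounded i)
      where
      extend : ∀ {i U} → Feasible S U → (∀ {k} → k ∈ U → k ⊴ i) → totalWeight S U ≡ dpMax i →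
        ∃ λ U → FeasibleUpTo i U × totalWeight S U ≡ dp i
      extend {i} {U} feasible before weight≡ = _ , insert-feasibleUpTo feasible before ,
        trans (totalWeight-insert S U i (insert-new feasible before))
          (trans (cong (weight (lookup S i) W.⊕_) weight≡) (sym (dp-recurrence i)))

      go : ∀ i → Acc Fin._<_ i → ∃ λ U → FeasibleUpTo i U × totalWeight S U ≡ dp i
      go i (acc rs) with max-sel weights W.0# (List.map dp (predecessors i))
      ... | inj₁ max≡0 = extend ∅-feasible ∅-before (trans (totalWeight-empty S ⊥ λ _ → ∉⊥) (sym max≡0))
      ... | inj₂ max∈ with ∈-map⁻ dp max∈
      ...   | j , j∈ , max≡dpⱼ with ∈-predecessors⁻ j∈
      ...     | j⊴i with go j (rs (⊴⇒< j⊴i))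
      ...       | U , (feasible , _ , upTo) , weight≡ =
        extend feasible (before-last upTo j⊴i) (trans weight≡ (sym max≡dpⱼ))

    -- Remove `i`. The last remaining activity `j`, if any, precedes `i` by feasibility, so the rest
    -- weighs at most `dp j`, one of the terms of the maximum.
    dp-upper : ∀ {i U} → FeasibleUpTo i U → totalWeight S U W.≤ dp i
    dp-upper {i} = go i (Fin.<-wellFounded i)
      where
      go : ∀ i → Acc Fin._<_ i → ∀ {U} → FeasibleUpTo i U → totalWeight S U W.≤ dp i
      go i (acc rs) {U} (feasible , i∈U , upTo) = subst₂ W._≤_ (sym weight≡) (sym (dp-recurrence i))
        (W.⊕-monoʳ-≤ _ (rest≤ (toMax U′)))
        where
        U′ = U [ i ]≔ false
        i∉U′ = ∉-[]≔-outside {U = U} {i}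
        weight≡ : totalWeight S U ≡ weight (lookup S i) W.⊕ totalWeight S U′
        weight≡ = trans (cong (totalWeight S) (sym ([]≔-restore i∈U)))
          (totalWeight-insert S U′ i (∉⇒outside i∉U′))
        ≢i : ∀ {j} → j ∈ U′ → j ≢ i
        ≢i j∈ refl = i∉U′ j∈
        old : ∀ {j} → j ∈ U′ → j ∈ U
        old j∈ = ∈-[]≔-other (≢i j∈) j∈
        rest≤ : _ → totalWeight S U′ W.≤ dpMax i
        rest≤ (inj₁ ∉U′) = subst (W._≤ dpMax i) (sym (totalWeight-empty S U′ ∉U′)) (⊥≤max W.0# (List.map dp (predecessors i)))
        rest≤ (inj₂ (j , j∈ , upToⱼ)) = WO.trans
          (go j (rs j<i) ((λ k∈ l∈ → feasible (old k∈) (old l∈)) , j∈ , upToⱼ))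
          (All.lookup (xs≤max W.0# (List.map dp (predecessors i))) (∈-map⁺ dp (∈-predecessors⁺ j⊴i)))
          where
          j<i : j Fin.< i
          j<i = Fin.≤∧≢⇒< (upTo (old j∈)) (≢i j∈)
          j⊴i : j ⊴ i
          j⊴i = <⇒⊴ (feasible i∈U (old j∈) (≢i j∈ ∘ sym)) j<i

    dp-isSolution : IsSolution S dp
    dp-isSolution = record
      { recurrence = dp-recurrence
      ; prefix     = λ i → dp-attained i , λ U → dp-upper
      ; optimum    = attained , upper
      }
      where
      attained : ∃ λ U → Feasible S U × totalWeight S U ≡ W.max W.0# (List.tabulate dp)
      attained with max-sel weights W.0# (List.tabulate dp)
      ... | inj₁ max≡0 = ⊥ , ∅-feasible , trans (totalWeight-empty S ⊥ λ _ → ∉⊥) (sym max≡0)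
      ... | inj₂ max∈ with ∈-tabulate⁻ max∈
      ...   | i , max≡dpᵢ with dp-attained i
      ...     | U , (feasible , _) , weight≡ = U , feasible , trans weight≡ (sym max≡dpᵢ)
      upper : ∀ U → Feasible S U → totalWeight S U W.≤ W.max W.0# (List.tabulate dp)
      upper U feasible with toMax U
      ... | inj₁ ∉U = subst (W._≤ _) (sym (totalWeight-empty S U ∉U)) (⊥≤max W.0# (List.tabulate dp))
      ... | inj₂ (i , i∈ , upTo) = WO.trans (dp-upper (feasible , i∈ , upTo))
        (All.lookup (xs≤max W.0# (List.tabulate dp)) (∈-tabulate⁺ i))

    -- Pivots and depth

    -- What the depth argument takes from the search; the choice among equally late starts stays
    -- open.
    record IsPivot (pivot : Fin n → Maybe (Fin n)) : Set where
      field
        pivot-⊴     : ∀ {x p} → pivot x ≡ just p → p ⊴ x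
        pivot-max   : ∀ {x p} → pivot x ≡ just p → ∀ {j} → j ⊴ x → start (lookup S j) T.≤ start (lookup S p)
        no-pivot    : ∀ {x} → pivot x ≡ nothing → ∀ {j} → ¬ (j ⊴ x)

    module Depth {pivot} (isPivot : IsPivot pivot) where
      open IsPivot isPivot

      private
        step : (Fin n → ℕ) → Fin n → ℕ
        step g x = Maybe.maybe′ (suc ∘ g) 0 (pivot x)

        step-local : ∀ {g h : Fin n → ℕ} {i} → (∀ {j} → j Fin.< i → g j ≡ h j) → step g i ≡ step h i
        step-local {i = i} g≡h with pivot i in eq
        ... | nothing = refl
        ... | just p  = cong suc (g≡h (⊴⇒< (pivot-⊴ eq)))

      open LocalFixpoint 0 step step-local public using () renaming (fix to depth; fix-unfold to depth-unfold)

      depth-just : ∀ {x p} → pivot x ≡ just p → depth x ≡ suc (depth p)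
      depth-just {x} eq = trans (depth-unfold x) (cong (Maybe.maybe′ (suc ∘ depth) 0) eq)

      depth-nothing : ∀ {x} → pivot x ≡ nothing → depth x ≡ 0
      depth-nothing {x} eq = trans (depth-unfold x) (cong (Maybe.maybe′ (suc ∘ depth) 0) eq)

      -- If `j` has pivot `p`, then `p` also ends by the start of `k`, so `k` has a pivot `q`
      -- starting no earlier than `p`. Induction applies to `p` and `q`.
      depth-mono : ∀ j k → start (lookup S j) T.≤ start (lookup S k) → depth j ℕ.≤ depth k
      depth-mono j k = go j (Fin.<-wellFounded j) k
        where
        go : ∀ j → Acc Fin._<_ j → ∀ k → start (lookup S j) T.≤ start (lookup S k) → depth j ℕ.≤ depth k
        go j (acc rs) k sⱼ≤sₖ with pivot j in eqⱼ
        ... | nothing = subst (ℕ._≤ depth k) (sym (depth-nothing eqⱼ)) z≤n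
        ... | just p with pivot k in eqₖ
        ...   | nothing = contradiction (T.trans (pivot-⊴ eqⱼ) sⱼ≤sₖ) (no-pivot eqₖ)
        ...   | just q  = subst₂ ℕ._≤_ (sym (depth-just eqⱼ)) (sym (depth-just eqₖ))
          (s≤s (go p (rs (⊴⇒< (pivot-⊴ eqⱼ))) q (pivot-max eqₖ (T.trans (pivot-⊴ eqⱼ) sⱼ≤sₖ))))

      ⊴⇒depth< : ∀ {i j} → j ⊴ i → depth j ℕ.< depth i
      ⊴⇒depth< {i} {j} j⊴i with pivot i in eq
      ... | nothing = contradiction j⊴i (no-pivot eq)
      ... | just p  = subst (depth j ℕ.<_) (sym (depth-just eq)) (s≤s (depth-mono j p (pivot-max eq j⊴i)))

      pivot-chain : ∀ x → ∃ λ U → FeasibleUpTo x U × ∣ U ∣ ≡ suc (depth x)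
      pivot-chain x = go x (Fin.<-wellFounded x)
        where
        extend : ∀ {x U d} → Feasible S U → (∀ {k} → k ∈ U → k ⊴ x) → ∣ U ∣ ≡ d → depth x ≡ d →
          ∃ λ U → FeasibleUpTo x U × ∣ U ∣ ≡ suc (depth x)
        extend {x} {U} feasible before refl depth≡ = _ , insert-feasibleUpTo feasible before ,
          trans (∣insert∣ U x (insert-new feasible before)) (cong suc (sym depth≡))

        go : ∀ x → Acc Fin._<_ x → ∃ λ U → FeasibleUpTo x U × ∣ U ∣ ≡ suc (depth x)
        go x (acc rs) with pivot x in eq
        ... | nothing = extend ∅-feasible ∅-before (∣⊥∣≡0 n) (depth-nothing eq)
        ... | just p with go p (rs (⊴⇒< (pivot-⊴ eq)))
        ...   | U , (feasible , _ , upTo) , ∣U∣≡ =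
          extend feasible (before-last upTo (pivot-⊴ eq)) ∣U∣≡ (depth-just eq)

      -- Ensures that suc n emptiness tests suffice, and bounds the rounds where no rank is given.
      depth<n : ∀ x → depth x ℕ.< n
      depth<n x with pivot-chain x
      ... | U , _ , ∣U∣≡ = subst (ℕ._≤ n) ∣U∣≡ (∣p∣≤n U)

      depth<rank : ∀ {r} → IsRank S r → ∀ x → depth x ℕ.< r
      depth<rank (_ , ∣∣≤r) x with pivot-chain x
      ... | U , (feasible , _) , ∣U∣≡ = subst (ℕ._≤ _) ∣U∣≡ (∣∣≤r U feasible)

-- Repetition-free concatenations and vectors

module _ {A : Set} where

  Unique-resp-↭ : ∀ {xs ys : List A} → xs ↭ ys → Uniqueˡ xs → Uniqueˡ ys
  Unique-resp-↭ xs↭ys = Permutationₛ.Unique-resp-↭ (setoid A) (↭⇒↭ₛ xs↭ys)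

  Unique-toList⁻ : ∀ {n} {xs : Vec A n} → Uniqueˡ (Vec.toList xs) → Uniqueᵛ xs
  Unique-toList⁻ {xs = []}     AllPairs.[]       = VecAllPairs.[]
  Unique-toList⁻ {xs = _ ∷ _} (x∉ AllPairs.∷ u) = VecAll.toList⁻ x∉ VecAllPairs.∷ Unique-toList⁻ u

  module _ {n} {g : Fin n → List A} where

    ∈-concat-tabulate⁺ : ∀ {x} i → x ∈ˡ g i → x ∈ˡ List.concat (List.tabulate g)
    ∈-concat-tabulate⁺ i x∈ = ∈-concat⁺′ x∈ (∈-tabulate⁺ i)

    ∈-concat-tabulate⁻ : ∀ {x} → x ∈ˡ List.concat (List.tabulate g) → ∃ λ i → x ∈ˡ g i
    ∈-concat-tabulate⁻ x∈ with ∈-concat⁻′ (List.tabulate g) x∈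
    ... | _ , x∈xs , xs∈ with ∈-tabulate⁻ xs∈
    ...   | i , refl = i , x∈xs

    Unique-concat-tabulate : (∀ i → Uniqueˡ (g i)) →
      (∀ {i j x} → x ∈ˡ g i → x ∈ˡ g j → i ≡ j) → Uniqueˡ (List.concat (List.tabulate g))
    Unique-concat-tabulate unique disjoint = Unique.concat⁺ (All.tabulate⁺ unique)
      (AllPairs.tabulate⁺ λ i≢j (x∈i , x∈j) → i≢j (disjoint x∈i x∈j))

lookup-ext : ∀ {A : Set} {n} {xs ys : Vec A n} → (∀ i → lookup xs i ≡ lookup ys i) → xs ≡ ys
lookup-ext {xs = xs} {ys} eq = trans (sym (Vec.tabulate∘lookup xs))
  (trans (Vec.tabulate-cong eq) (Vec.tabulate∘lookup ys))

lookup⇒∈ : ∀ {A : Set} {n} {xs : Vec A n} i {x} → lookup xs i ≡ x → x ∈ᵛ xs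
lookup⇒∈ {xs = xs} i refl = Vec.∈-lookup i xs

∈-toList⇒lookup : ∀ {A : Set} {n} (xs : Vec A n) {x} → x ∈ˡ Vec.toList xs → ∃ λ i → x ≡ lookup xs i
∈-toList⇒lookup xs x∈ = ∈-tabulate⁻ (subst (_ ∈ˡ_) (toList-tabulate-lookup xs) x∈)

Unique⇒length≤n : ∀ {n} {xs : List (Fin n)} → Uniqueˡ xs → List.length xs ≤ n
Unique⇒length≤n {n} {xs} u = subst (List.length xs ≤_) (List.length-tabulate {n = n} id) (Unique-⊆⇒length≤ u (λ _ → ∈-allFin _))

-- Runs of the Type 2 algorithm

-- s, d and m are the constants of the start-time tree, T_DP and T_pivot.
roundConstant : ℕ → ℕ → ℕ
roundConstant d m = suc ((2 + (d + 3) + 4) + (d + (2 * suc m + 10)))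

totalConstant : ℕ → ℕ → ℕ → ℕ
totalConstant s d m = (2 + 4) + (s + ((1 + (s + 1) + 4) + ((2 * 2 + 10) + (m +
  ((2 + 4) + (d + ((2 * 2 + 10) + (4 * roundConstant d m + 1))))))))

module Algorithm (time : DecTotalOrder 0ℓ 0ℓ 0ℓ) (weights : OrderedMonoid)
  (startTrees : RangeMaxTrees time time)
  (dpTrees : RangeMaxTrees time (OrderedMonoid.decTotalOrder weights))
  (pivotMaps : MultiMaps)
  {n : ℕ} (S : Vec (ActivitySelection.Activity time weights) n)
  (sorted : ActivitySelection.SortedByEnd time weights S) where

  open ActivitySelection time weights
  open Type2 startTrees dpTrees pivotMaps
  open SortedActivities time weights S sorted
  private
    module T = DecTotalOrder time
    module W = OrderedMonoid weights
    module WO = DecTotalOrder W.decTotalOrder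
    module Start = RangeMaxTrees startTrees
    module DP    = RangeMaxTrees dpTrees
    module M     = MultiMaps pivotMaps

  -- Pivots found by the run

  startEntry : Fin n → Comp (Entry time time)
  startEntry i = load S i >>= λ a → instr (end a , just (start a))

  es : Vec (Entry time time) n
  es = run (parFor n startEntry)

  lookup-es : ∀ i → lookup es i ≡ (end (lookup S i) , just (start (lookup S i)))
  lookup-es i = lookup-parFor n startEntry i

  es-sorted : Sorted time time es
  es-sorted {i} {j} i≤j rewrite lookup-es i | lookup-es j = sorted i≤j

  Tₛ : Start.Tree n
  Tₛ = run (Start.build es)

  entry-Tₛ : ∀ i → Start.entry Tₛ i ≡ (end (lookup S i) , just (start (lookup S i)))
  entry-Tₛ i = trans (Start.build-correct es es-sorted i) (lookup-es i)

  pivots : Vec (Maybe (Fin n)) n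
  pivots = run (parFor n (findPivot S Tₛ))

  pivot : Fin n → Maybe (Fin n)
  pivot = lookup pivots

  pivot≡ : ∀ x → pivot x ≡ Maybe.map proj₁ (run (Start.rangeMax Tₛ (start (lookup S x))))
  pivot≡ x = trans (lookup-parFor n (findPivot S Tₛ) x)
    (run->>= (Start.rangeMax Tₛ (start (lookup S x))) _)

  isPivot : IsPivot pivot
  isPivot = record
    { pivot-⊴   = λ {x} → pivot-⊴′ _ (pivot≡ x) (Start.rangeMax-correct Tₛ _)
    ; pivot-max = λ {x} → pivot-max′ _ (pivot≡ x) (Start.rangeMax-correct Tₛ _)
    ; no-pivot  = λ {x} → no-pivot′ _ (pivot≡ x) (Start.rangeMax-correct Tₛ _)
    }
    where
    key : ∀ {x} j → proj₁ (Start.entry Tₛ j) T.≤ start (lookup S x) → j ⊴ x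
    key j rewrite entry-Tₛ j = id
    key⁻¹ : ∀ {x} j → j ⊴ x → proj₁ (Start.entry Tₛ j) T.≤ start (lookup S x)
    key⁻¹ j rewrite entry-Tₛ j = id
    value : ∀ j → proj₂ (Start.entry Tₛ j) ≡ just (start (lookup S j))
    value j = cong proj₂ (entry-Tₛ j)

    -- The query result is a variable `r`, so that matching on it also refines its specification.
    pivot-⊴′ : ∀ {x p} r → pivot x ≡ Maybe.map proj₁ r →
      IsRangeMax time time (Start.entry Tₛ) (start (lookup S x)) r → pivot x ≡ just p → p ⊴ x
    pivot-⊴′ nothing        eq _        px with () ← trans (sym eq) px
    pivot-⊴′ (just (p , _)) eq (k≤ , _) px with refl ← trans (sym eq) px = key p k≤

    pivot-max′ : ∀ {x p} r → pivot x ≡ Maybe.map proj₁ r →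
      IsRangeMax time time (Start.entry Tₛ) (start (lookup S x)) r → pivot x ≡ just p →
      ∀ {j} → j ⊴ x → start (lookup S j) T.≤ start (lookup S p)
    pivot-max′ nothing        eq _                px with () ← trans (sym eq) px
    pivot-max′ (just (p , _)) eq (_ , v≡ , v-max) px {j} j⊴x with refl ← trans (sym eq) px =
      subst (_ T.≤_) (just-injective (trans (sym v≡) (value p))) (v-max j (key⁻¹ j j⊴x) (value j))

    no-pivot′ : ∀ {x} r → pivot x ≡ Maybe.map proj₁ r →
      IsRangeMax time time (Start.entry Tₛ) (start (lookup S x)) r → pivot x ≡ nothing → ∀ {j} → ¬ (j ⊴ x)
    no-pivot′ nothing  eq none px {j} j⊴x with () ← trans (sym (value j)) (none j (key⁻¹ j j⊴x))
    no-pivot′ (just _) eq _    px         with () ← trans (sym eq) px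

  open Depth isPivot

  -- The pivot multi-map

  pairOf : Fin n → List (Fin n × Fin n)
  pairOf x = toList (run (pivotPair S pivots x))

  pairOf-just : ∀ {x p} → pivot x ≡ just p → pairOf x ≡ (p , x) ∷ []
  pairOf-just eq rewrite eq = refl

  ∈-pairOf⁻ : ∀ {q} x → q ∈ˡ pairOf x → pivot x ≡ just (proj₁ q) × x ≡ proj₂ q
  ∈-pairOf⁻ x q∈ with pivot x
  ∈-pairOf⁻ x (here refl) | just p = refl , refl

  ps : Array (Fin n × Fin n)
  ps = run (collect n (pivotPair S pivots))

  Tₚ : M.MultiMap n
  Tₚ = run (M.fromPairs (proj₂ ps))

  pairs-↭ : M.pairs Tₚ ↭ List.concat (List.tabulate pairOf)
  pairs-↭ = subst (M.pairs Tₚ ↭_) (toList-collect n (pivotPair S pivots)) (M.fromPairs-correct (proj₂ ps))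

  -- The second component of a pair names the iteration that produced it, and each iteration
  -- produces at most one pair. Hence there are at most n pairs, as the multi-map costs require, and
  -- a key has no repeated values.
  pairs-unique : Uniqueˡ (List.map proj₂ (M.pairs Tₚ))
  pairs-unique = Unique-resp-↭ (↭-map⁺ proj₂ (↭-sym pairs-↭)) (subst Uniqueˡ eq
    (Unique-concat-tabulate unique disjoint))
    where
    eq : List.concat (List.tabulate (List.map proj₂ ∘ pairOf)) ≡ List.map proj₂ (List.concat (List.tabulate pairOf))
    eq = trans (cong List.concat (sym (List.map-tabulate pairOf (List.map proj₂)))) (List.concat-map (List.tabulate pairOf))
    unique : ∀ x → Uniqueˡ (List.map proj₂ (pairOf x))
    unique x with pivot x
    ... | just p  = All.[] AllPairs.∷ AllPairs.[]
    ... | nothing = AllPairs.[]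
    owner : ∀ {x y} → y ∈ˡ List.map proj₂ (pairOf x) → x ≡ y
    owner {x} y∈ with ∈-map⁻ proj₂ y∈
    ... | q , q∈ , refl = proj₂ (∈-pairOf⁻ x q∈)
    disjoint : ∀ {x x′ y} → y ∈ˡ List.map proj₂ (pairOf x) → y ∈ˡ List.map proj₂ (pairOf x′) → x ≡ x′
    disjoint y∈ y∈′ = trans (owner y∈) (sym (owner y∈′))

  pairs-length : List.length (M.pairs Tₚ) ≤ n
  pairs-length = subst (_≤ n) (List.length-map proj₂ (M.pairs Tₚ)) (Unique⇒length≤n pairs-unique)

  ps-length : proj₁ ps ≤ n
  ps-length = subst (_≤ n) (trans (↭-length (M.fromPairs-correct (proj₂ ps))) (Vec.length-toList (proj₂ ps))) pairs-length

  children : Fin n → List (Fin n)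
  children y = toList (run (M.find Tₚ y))

  ∈-children⁺ : ∀ {x y} → pivot x ≡ just y → x ∈ˡ children y
  ∈-children⁺ {x} {y} eq = ∈-resp-↭ (↭-sym (M.find-correct Tₚ y))
    (∈-map⁺ proj₂ (∈-filter⁺ (λ p → proj₁ p Fin.≟ y)
      (∈-resp-↭ (↭-sym pairs-↭) (∈-concat-tabulate⁺ x (subst ((y , x) ∈ˡ_) (sym (pairOf-just eq)) (here refl))))
      refl))

  ∈-children⁻ : ∀ {x y} → x ∈ˡ children y → pivot x ≡ just y
  ∈-children⁻ {x} {y} x∈ with ∈-map⁻ proj₂ (∈-resp-↭ (M.find-correct Tₚ y) x∈)
  ... | (y′ , x) , q∈ , refl with ∈-filter⁻ (λ p → proj₁ p Fin.≟ y) {xs = M.pairs Tₚ} q∈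
  ...   | q∈pairs , refl with ∈-concat-tabulate⁻ (∈-resp-↭ pairs-↭ q∈pairs)
  ...     | z , q∈z with ∈-pairOf⁻ z q∈z
  ...       | eq , refl = eq

  children-unique : ∀ y → Uniqueˡ (children y)
  children-unique y = Unique-resp-↭ (↭-sym (M.find-correct Tₚ y))
    (AllPairs.map⁺ (AllPairs.filter⁺ (λ p → proj₁ p Fin.≟ y) (AllPairs.map⁻ pairs-unique)))

  -- Frontiers as levels of equal depth

  -- `unique` makes a frontier an admissible batch of at most n updates, `sound` places its queries
  -- among finished activities, and `full` guarantees that a round omits nothing.
  record IsLevel (d : ℕ) (xs : List (Fin n)) : Set where
    field
      unique : Uniqueˡ xs
      sound  : ∀ {x} → x ∈ˡ xs → depth x ≡ d
      full   : ∀ {x} → depth x ≡ d → x ∈ˡ xs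

  level-length : ∀ {d m} {F : Vec (Fin n) m} → IsLevel d (Vec.toList F) → m ≤ n
  level-length {F = F} level = subst (_≤ n) (Vec.length-toList F) (Unique⇒length≤n (IsLevel.unique level))

  F₀ : Array (Fin n)
  F₀ = run (collect n (rankOne S pivots))

  level₀ : IsLevel 0 (Vec.toList (proj₂ F₀))
  level₀ rewrite toList-collect n (rankOne S pivots) = record
    { unique = Unique-concat-tabulate unique (λ y∈ y∈′ → trans (sym (owner _ y∈)) (owner _ y∈′))
    ; sound  = sound
    ; full   = full
    }
    where
    roots : Fin n → List (Fin n)
    roots x = toList (run (rankOne S pivots x))
    roots-nothing : ∀ {x} → pivot x ≡ nothing → roots x ≡ x ∷ []
    roots-nothing eq rewrite eq = refl
    unique : ∀ x → Uniqueˡ (roots x)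
    unique x with pivot x
    ... | just p  = AllPairs.[]
    ... | nothing = All.[] AllPairs.∷ AllPairs.[]
    root : ∀ {y} x → y ∈ˡ roots x → y ≡ x × pivot x ≡ nothing
    root x y∈ with pivot x
    root x (here refl) | nothing = refl , refl
    owner : ∀ {y} x → y ∈ˡ roots x → y ≡ x
    owner x y∈ = proj₁ (root x y∈)
    sound : ∀ {y} → y ∈ˡ List.concat (List.tabulate roots) → depth y ≡ 0
    sound y∈ with ∈-concat-tabulate⁻ y∈
    ... | x , y∈x with root x y∈x
    ...   | refl , eq = depth-nothing eq
    full : ∀ {y} → depth y ≡ 0 → y ∈ˡ List.concat (List.tabulate roots)
    full {y} d≡0 with pivot y in eq
    ... | just p with () ← trans (sym d≡0) (depth-just eq)
    full {y} d≡0 | nothing = ∈-concat-tabulate⁺ y (subst (y ∈ˡ_) (sym (roots-nothing eq)) (here refl))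

  nextFrontier : ∀ {m} → Vec (Fin n) m → Comp (Array (Fin n))
  nextFrontier {m} F = collect m (λ i → instr (lookup F i) >>= M.find Tₚ)

  level-suc : ∀ {d m} {F : Vec (Fin n) m} → IsLevel d (Vec.toList F) →
    IsLevel (suc d) (Vec.toList (proj₂ (run (nextFrontier F))))
  level-suc {d} {m} {F} level rewrite toList-collect m (λ i → instr (lookup F i) >>= M.find Tₚ) = record
    { unique = Unique-concat-tabulate (λ i → children-unique (lookup F i)) disjoint
    ; sound  = sound′
    ; full   = full′
    }
    where
    open IsLevel level
    disjoint : ∀ {i j x} → x ∈ˡ children (lookup F i) → x ∈ˡ children (lookup F j) → i ≡ j
    disjoint {i} {j} x∈i x∈j = VecUnique.lookup-injective (Unique-toList⁻ unique) i j
      (just-injective (trans (sym (∈-children⁻ x∈i)) (∈-children⁻ x∈j)))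
    sound′ : ∀ {x} → x ∈ˡ List.concat (List.tabulate (children ∘ lookup F)) → depth x ≡ suc d
    sound′ x∈ with ∈-concat-tabulate⁻ x∈
    ... | i , x∈i = trans (depth-just (∈-children⁻ x∈i))
      (cong suc (sound (Vec.∈-toList⁺ (Vec.∈-lookup i F))))
    full′ : ∀ {x} → depth x ≡ suc d → x ∈ˡ List.concat (List.tabulate (children ∘ lookup F))
    full′ {x} d≡ with pivot x in eq
    ... | nothing with () ← trans (sym d≡) (depth-nothing eq)
    full′ {x} d≡ | just p with ∈-toList⇒lookup F (full (ℕ.suc-injective (trans (sym (depth-just eq)) d≡)))
    ...   | i , refl = ∈-concat-tabulate⁺ i (∈-children⁺ eq)

  -- Depth drops by exactly one along pivots, so from any activity of depth at least `d` they lead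
  -- to one of depth `d`, which an empty level excludes.
  level-[] : ∀ {d} → IsLevel d [] → ∀ x → depth x < d
  level-[] {d} level x with depth x ℕ.<? d
  ... | yes <d = <d
  ... | no ≮d = ⊥-elim (go x (Fin.<-wellFounded x) (ℕ.≮⇒≥ ≮d))
    where
    open IsPivot isPivot
    go : ∀ x → Acc Fin._<_ x → ¬ (d ≤ depth x)
    go x (acc rs) d≤ with ℕ.m≤n⇒m<n∨m≡n d≤
    ... | inj₂ d≡ with () ← IsLevel.full level (sym d≡)
    go x (acc rs) d≤ | inj₁ d< with pivot x in eq
    ... | nothing with () ← subst (d <_) (depth-nothing eq) d<
    ... | just p = go p (rs (⊴⇒< (pivot-⊴ eq))) (ℕ.s≤s⁻¹ (subst (d <_) (depth-just eq) d<))

  -- Contents of the DP tree between rounds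

  open NaturalMax W.totalOrder using (x≤x⊔y; x≤y⊔x; ⊔-sel)

  record Filled (d : ℕ) (T : DP.Tree n) : Set where
    field
      keys   : ∀ i → proj₁ (DP.entry T i) ≡ end (lookup S i)
      done   : ∀ {i} → depth i < d → proj₂ (DP.entry T i) ≡ just (dp i)
      undone : ∀ {i} → d ≤ depth i → proj₂ (DP.entry T i) ≡ nothing

  dpEntry : Fin n → Comp (Entry time W.decTotalOrder)
  dpEntry i = load S i >>= λ a → instr (end a , nothing)

  es′ : Vec (Entry time W.decTotalOrder) n
  es′ = run (parFor n dpEntry)

  lookup-es′ : ∀ i → lookup es′ i ≡ (end (lookup S i) , nothing)
  lookup-es′ = lookup-parFor n dpEntry

  es′-sorted : Sorted time W.decTotalOrder es′
  es′-sorted {i} {j} i≤j rewrite lookup-es′ i | lookup-es′ j = sorted i≤j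

  T₀ : DP.Tree n
  T₀ = run (DP.build es′)

  entry-T₀ : ∀ i → DP.entry T₀ i ≡ (end (lookup S i) , nothing)
  entry-T₀ i = trans (DP.build-correct es′ es′-sorted i) (lookup-es′ i)

  filled₀ : Filled 0 T₀
  filled₀ = record
    { keys   = λ i → cong proj₁ (entry-T₀ i)
    ; done   = λ ()
    ; undone = λ {i} _ → cong proj₂ (entry-T₀ i)
    }

  module _ {d T} (filled : Filled d T) where
    open Filled filled

    fromRangeMax : Maybe (Fin n × W.Carrier) → W.Carrier
    fromRangeMax = Maybe.maybe′ (λ m → W.0# W.⊔ʷ proj₂ m) W.0#

    rangeMax-dpMax : ∀ {i} → depth i ≡ d → ∀ r →
      IsRangeMax time W.decTotalOrder (DP.entry T) (start (lookup S i)) r → fromRangeMax r ≡ dpMax i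
    rangeMax-dpMax {i} refl r isMax = max-characterisation weights (base r) (upper r isMax) (attained r isMax)
      where
      query : ∀ {j} → j ⊴ i → proj₁ (DP.entry T j) T.≤ start (lookup S i)
      query {j} = subst (T._≤ start (lookup S i)) (sym (keys j))
      query⁻¹ : ∀ {j} → proj₁ (DP.entry T j) T.≤ start (lookup S i) → j ⊴ i
      query⁻¹ {j} = subst (T._≤ start (lookup S i)) (keys j)
      base : ∀ r → W.0# W.≤ fromRangeMax r
      base nothing  = WO.refl
      base (just m) = x≤x⊔y _ _
      upper : ∀ r → IsRangeMax time W.decTotalOrder (DP.entry T) (start (lookup S i)) r →
        ∀ {v} → v ∈ˡ List.map dp (predecessors i) → v W.≤ fromRangeMax r
      upper r isMax v∈ with ∈-map⁻ dp v∈
      -- An empty answer contradicts a predecessor, whose value is already present.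
      upper nothing none _ | j , j∈ , refl
        with () ← trans (sym (done (⊴⇒depth< (∈-predecessors⁻ j∈)))) (none j (query (∈-predecessors⁻ j∈)))
      upper (just (_ , m)) (_ , _ , m-max) _ | j , j∈ , refl =
        WO.trans (m-max j (query (∈-predecessors⁻ j∈)) (done (⊴⇒depth< (∈-predecessors⁻ j∈)))) (x≤y⊔x W.0# m)
      attained : ∀ r → IsRangeMax time W.decTotalOrder (DP.entry T) (start (lookup S i)) r →
        fromRangeMax r ≡ W.0# ⊎ fromRangeMax r ∈ˡ List.map dp (predecessors i)
      attained nothing        _              = inj₁ refl
      attained (just (j , m)) (j≤ , m≡ , _) with ⊔-sel W.0# m
      ... | inj₁ ≡0 = inj₁ ≡0
      ... | inj₂ ≡m = inj₂ (subst (_∈ˡ List.map dp (predecessors i))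
        (trans (just-injective (trans (sym (done (⊴⇒depth< (query⁻¹ j≤)))) m≡)) (sym ≡m))
        (∈-map⁺ dp (∈-predecessors⁺ (query⁻¹ j≤))))

    dpValue-correct : ∀ {i} → depth i ≡ d → run (dpValue S T i) ≡ (i , dp i)
    dpValue-correct {i} depth≡ = trans (run->>= (DP.rangeMax T (start (lookup S i))) _)
      (cong (i ,_) (trans
        (cong (weight (lookup S i) W.⊕_) (rangeMax-dpMax depth≡ _ (DP.rangeMax-correct T _)))
        (sym (dp-recurrence i))))

  dpItem : ∀ {m} → Vec (Fin n) m → DP.Tree n → Fin m → Comp (Fin n × W.Carrier)
  dpItem F T i = instr (lookup F i) >>= dpValue S T

  updates : ∀ {m} → Vec (Fin n) m → DP.Tree n → Vec (Fin n × W.Carrier) m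
  updates {m} F T = run (parFor m (dpItem F T))

  module _ {d T m} {F : Vec (Fin n) m} (filled : Filled d T) (level : IsLevel d (Vec.toList F)) where
    open IsLevel level

    lookup-updates : ∀ j → lookup (updates F T) j ≡ (lookup F j , dp (lookup F j))
    lookup-updates j = trans (lookup-parFor m (dpItem F T) j)
      (dpValue-correct filled (sound (Vec.∈-toList⁺ (Vec.∈-lookup j F))))

    updates-keys : Vec.map proj₁ (updates F T) ≡ F
    updates-keys = lookup-ext λ j → trans (Vec.lookup-map j proj₁ (updates F T)) (cong proj₁ (lookup-updates j))

    updates-unique : Uniqueᵛ (Vec.map proj₁ (updates F T))
    updates-unique = subst Uniqueᵛ (sym updates-keys) (Unique-toList⁻ unique)

    update-level : ∀ {i} → depth i ≡ d →
      DP.entry (run (DP.update T (updates F T))) i ≡ (proj₁ (DP.entry T i) , just (dp i))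
    update-level {i} depth≡ with ∈-toList⇒lookup F (full depth≡)
    ... | j , refl = DP.update-new T (updates F T) updates-unique (lookup⇒∈ j (lookup-updates j))

    update-other : ∀ {i} → depth i ≢ d → DP.entry (run (DP.update T (updates F T))) i ≡ DP.entry T i
    update-other depth≢ = DP.update-old T (updates F T) updates-unique
      λ i∈ → depth≢ (sound (Vec.∈-toList⁺ (subst (_ ∈ᵛ_) updates-keys i∈)))

    filled-suc : Filled (suc d) (run (DP.update T (updates F T)))
    filled-suc = record { keys = keys′ ; done = done′ ; undone = undone′ }
      where
      open Filled filled
      keys′ : ∀ i → _ ≡ end (lookup S i)
      keys′ i with depth i ℕ.≟ d
      ... | yes depth≡ = trans (cong proj₁ (update-level depth≡)) (keys i)
      ... | no  depth≢ = trans (cong proj₁ (update-other depth≢)) (keys i)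
      done′ : ∀ {i} → depth i < suc d → _ ≡ just (dp i)
      done′ {i} <1+d with depth i ℕ.≟ d
      ... | yes depth≡ = cong proj₂ (update-level depth≡)
      ... | no  depth≢ = trans (cong proj₂ (update-other depth≢)) (done (ℕ.≤∧≢⇒< (ℕ.s≤s⁻¹ <1+d) depth≢))
      undone′ : ∀ {i} → suc d ≤ depth i → _ ≡ nothing
      undone′ d< = trans (cong proj₂ (update-other (ℕ.>⇒≢ d<))) (undone (ℕ.<⇒≤ d<))

  -- Cost of the rounds

  -- The activities finished before round `d`; their number drives the potential for the work.
  shallow : ℕ → List (Fin n)
  shallow d = List.filter (λ x → depth x ℕ.<? d) (List.allFin n)

  shallow-suc : ∀ {d m} {F : Vec (Fin n) m} → IsLevel d (Vec.toList F) →
    List.length (shallow d) + m ≤ List.length (shallow (suc d))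
  shallow-suc {d} {m} {F} level = subst (_≤ List.length (shallow (suc d)))
    (trans (List.length-++ (shallow d)) (cong (List.length (shallow d) +_) (Vec.length-toList F)))
    (Unique-⊆⇒length≤
      (Unique.++⁺ (Unique.filter⁺ (λ x → depth x ℕ.<? d) (Unique.allFin⁺ n)) unique disjoint)
      (λ x∈ → member (∈-++⁻ (shallow d) x∈)))
    where
    open IsLevel level
    depth< : ∀ {x} → x ∈ˡ shallow d → depth x < d
    depth< x∈ = proj₂ (∈-filter⁻ (λ x → depth x ℕ.<? d) {xs = List.allFin n} x∈)
    disjoint : ∀ {x} → ¬ (x ∈ˡ shallow d × x ∈ˡ Vec.toList F)
    disjoint (x∈ , x∈F) = ℕ.<⇒≢ (depth< x∈) (sound x∈F)
    deeper : ∀ {x} → depth x < suc d → x ∈ˡ shallow (suc d)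
    deeper = ∈-filter⁺ (λ x → depth x ℕ.<? suc d) (∈-allFin _)
    member : ∀ {x} → x ∈ˡ shallow d ⊎ x ∈ˡ Vec.toList F → x ∈ˡ shallow (suc d)
    member (inj₁ x∈) = deeper (ℕ.m<n⇒m<1+n (depth< x∈))
    member (inj₂ x∈) = deeper (s≤s (ℕ.≤-reflexive (sound x∈)))

  shallow-length : ∀ d → List.length (shallow d) ≤ n
  shallow-length d = Unique⇒length≤n (Unique.filter⁺ (λ x → depth x ℕ.<? d) (Unique.allFin⁺ n))

  private
    ℓ = lg n

  0<ℓ : 0 < ℓ
  0<ℓ = s≤s z≤n

  roundCost : ℕ
  roundCost = roundConstant DP.c M.c

  module _ {m} (F : Vec (Fin n) m) (T : DP.Tree n) (m≤n : m ≤ n) where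

    dpItem-Costs : ∀ i → Costs ℓ ℓ (2 + (DP.c + 3)) (dpItem F T i)
    dpItem-Costs i = Costs-tick 0<ℓ 0<ℓ (Costs-tick 0<ℓ 0<ℓ
      (sequential {p = DP.rangeMax T (start (lookup S (lookup F i)))} (DP.rangeMax-work T _) >>=ᶜ
        Costs-tick 0<ℓ 0<ℓ (Costs-tick 0<ℓ 0<ℓ (Costs-instr 0<ℓ 0<ℓ))))

    updates-Costs : ∀ {N} → m < N → Costs (N * ℓ) ℓ (2 + (DP.c + 3) + 4) (parFor m (dpItem F T))
    updates-Costs m<N = parFor-Costs 0<ℓ (⌈log₂n⌉≤lg m≤n) m<N dpItem-Costs

    update-Costs : ∀ {N} {us : Vec (Fin n × W.Carrier) m} → Uniqueᵛ (Vec.map proj₁ us) → m < N →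
      Costs (N * ℓ) ℓ DP.c (DP.update T us)
    update-Costs unique m<N = Costs-mono (ℕ.*-monoˡ-≤ ℓ m<N) ℕ.≤-refl ℕ.≤-refl
      (DP.update-work T _ unique m≤n , DP.update-span T _ unique m≤n)

    nextFrontier-Costs : ∀ {N} → m < N → let m′ = proj₁ (run (nextFrontier F)) in m′ ≤ n → m′ < N →
      Costs (N * ℓ) ℓ (2 * suc M.c + 10) (nextFrontier F)
    nextFrontier-Costs m<N m′≤n m′<N =
      collect-Costs 0<ℓ (⌈log₂n⌉≤lg m≤n) (⌈log₂n⌉≤lg m′≤n) m<N m′<N
        (λ i → Costs-tick 0<ℓ 0<ℓ (sequential (M.find-work Tₚ (lookup F i) pairs-length)))
        -- `collect-Costs` has one constant for cost and height. The cost fixes it at suc M.c, which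
        -- leaves the height one ℓ to spare.
        (λ i → ℕ.≤-trans (M.find-height Tₚ (lookup F i) pairs-length) (ℕ.m≤n+m _ ℓ))

  -- `R` stays open: it is n for the result and the work, which are claimed without reference to a
  -- rank, and the rank for the span.
  module Rounds (R : ℕ) (depth<R : ∀ x → depth x < R) where

    -- The potential 2 |shallow d| + m is at most 2 n and grows by at least
    -- m + m′ in a round from a frontier of m activities to one of m′, which
    -- pays for the O((m + m′) log n) work of that round.
    record Outcome (k d : ℕ) (F : Array (Fin n)) (T : DP.Tree n) : Set where
      field
        result     : ∃ λ T′ → run (rounds S k Tₚ F T) ≡ just T′ × (∀ i → proj₂ (DP.entry T′ i) ≡ just (dp i))
        work-bound : work (rounds S k Tₚ F T) + 2 * (roundCost * ℓ) * (2 * List.length (shallow d) + proj₁ F)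
                       ≤ 2 * (roundCost * ℓ) * (2 * n) + 1
        span-bound : span (rounds S k Tₚ F T) + roundCost * ℓ * d ≤ roundCost * ℓ * R + 1

    -- Running out of fuel would mean d = n + 1, against d ≤ n. A nonempty frontier exhibits an
    -- activity of depth `d`, so `d` is below n and `R` and both bounds survive the round. The
    -- summand 1 in the outcome is the last emptiness test.
    rounds-outcome : ∀ k {d m} {F : Vec (Fin n) m} {T} → k + d ≡ suc n → d ≤ n → d ≤ R →
      IsLevel d (Vec.toList F) → Filled d T → Outcome k d (m , F) T
    rounds-outcome zero refl d≤n = contradiction d≤n ℕ.1+n≰n
    rounds-outcome (suc k) {d} {zero} {[]} {T} k+d d≤n d≤R level filled = record
      { result     = T , refl , λ i → Filled.done filled (level-[] level i)
      ; work-bound = begin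
          1 + b * (2 * s + 0)  ≡⟨ ℕ.+-comm 1 _ ⟩
          b * (2 * s + 0) + 1  ≡⟨ cong (λ x → b * x + 1) (ℕ.+-identityʳ (2 * s)) ⟩
          b * (2 * s) + 1      ≤⟨ ℕ.+-monoˡ-≤ 1 (ℕ.*-monoʳ-≤ b (ℕ.*-monoʳ-≤ 2 (shallow-length d))) ⟩
          b * (2 * n) + 1      ∎
      ; span-bound = begin
          1 + roundCost * ℓ * d  ≡⟨ ℕ.+-comm 1 _ ⟩
          roundCost * ℓ * d + 1  ≤⟨ ℕ.+-monoˡ-≤ 1 (ℕ.*-monoʳ-≤ (roundCost * ℓ) d≤R) ⟩
          roundCost * ℓ * R + 1  ∎
      }
      where
      open ℕ.≤-Reasoning
      b = 2 * (roundCost * ℓ)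
      s = List.length (shallow d)
    rounds-outcome (suc k) {d} {m@(suc _)} {F} {T} k+d d≤n d≤R level filled = record
      { result     = proj₁ result , trans run≡ (proj₁ (proj₂ result)) , proj₂ (proj₂ result)
      ; work-bound = begin
          work (rounds S (suc k) Tₚ (m , F) T) + b * (2 * s + m)
            ≤⟨ ℕ.+-monoˡ-≤ (b * (2 * s + m)) workBound ⟩
          (roundCost * (N * ℓ) + w′) + b * (2 * s + m)
            ≤⟨ ℕ.+-monoˡ-≤ (b * (2 * s + m)) (ℕ.+-monoˡ-≤ w′
                 (ℕ.*-monoʳ-≤ roundCost (ℕ.*-monoˡ-≤ ℓ N≤))) ⟩
          (roundCost * (2 * (m + m′) * ℓ) + w′) + b * (2 * s + m)
            ≡⟨ regroup roundCost ℓ m m′ w′ s ⟩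
          w′ + b * (2 * (s + m) + m′)
            ≤⟨ ℕ.+-monoʳ-≤ w′ (ℕ.*-monoʳ-≤ b (ℕ.+-monoˡ-≤ m′ (ℕ.*-monoʳ-≤ 2 (shallow-suc level)))) ⟩
          w′ + b * (2 * List.length (shallow (suc d)) + m′)
            ≤⟨ work-bound ⟩
          b * (2 * n) + 1 ∎
      ; span-bound = begin
          span (rounds S (suc k) Tₚ (m , F) T) + roundCost * ℓ * d
            ≤⟨ ℕ.+-monoˡ-≤ (roundCost * ℓ * d) spanBound ⟩
          (roundCost * ℓ + s′) + roundCost * ℓ * d
            ≡⟨ regroup′ (roundCost * ℓ) s′ d ⟩
          s′ + roundCost * ℓ * suc d
            ≤⟨ span-bound ⟩
          roundCost * ℓ * R + 1 ∎
      }
      where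
      open ℕ.≤-Reasoning
      b = 2 * (roundCost * ℓ)
      s = List.length (shallow d)
      us = updates F T
      T′ = run (DP.update T us)
      F′ = run (nextFrontier F)
      m′ = proj₁ F′
      N = suc (m + m′)
      rest = rounds S k Tₚ F′ T′
      w′ = work rest
      s′ = span rest

      depth₀ : depth (lookup F zero) ≡ d
      depth₀ = IsLevel.sound level (Vec.∈-toList⁺ (Vec.∈-lookup zero F))

      open Outcome (rounds-outcome k (trans (ℕ.+-suc k d) k+d)
        (subst (_< n) depth₀ (depth<n _)) (subst (_< R) depth₀ (depth<R _))
        (level-suc level) (filled-suc filled level))

      m≤n : m ≤ n
      m≤n = level-length level
      m<N : m < N
      m<N = s≤s (ℕ.m≤m+n m m′)
      m′<N : m′ < N
      m′<N = s≤s (ℕ.m≤n+m m′ m)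
      -- As `m` is positive here, the extra unit in `N` is absorbed by doubling; this is the leading
      -- 2 in `b`.
      N≤ : N ≤ 2 * (m + m′)
      N≤ = ℕ.+-mono-≤ (s≤s z≤n) (ℕ.≤-reflexive (sym (ℕ.+-identityʳ (m + m′))))

      costs₁ = updates-Costs F T m≤n m<N
      costs₂ = update-Costs F T m≤n (updates-unique filled level) m<N
      costs₃ = nextFrontier-Costs F T m≤n m<N (level-length (level-suc level)) m′<N

      run≡ : run (rounds S (suc k) Tₚ (m , F) T) ≡ run rest
      run≡ = trans (run->>= (parFor m (dpItem F T)) _)
        (trans (run->>= (DP.update T us) _) (run->>= (nextFrontier F) _))

      chain : ∀ X c₁ c₂ c₃ {y x₁ x₂ x₃ z} → 0 < X → y ≡ suc (x₁ + (x₂ + (x₃ + z))) →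
        x₁ ≤ c₁ * X → x₂ ≤ c₂ * X → x₃ ≤ c₃ * X → y ≤ suc (c₁ + (c₂ + c₃)) * X + z
      chain X c₁ c₂ c₃ {y} {x₁} {x₂} {x₃} {z} 0<X y≡ x₁≤ x₂≤ x₃≤ = begin
        y                                             ≡⟨ y≡ ⟩
        1 + (x₁ + (x₂ + (x₃ + z)))                    ≤⟨ ℕ.+-mono-≤ 0<X (ℕ.+-mono-≤ x₁≤ (ℕ.+-mono-≤ x₂≤ (ℕ.+-monoˡ-≤ z x₃≤))) ⟩
        X + (c₁ * X + (c₂ * X + (c₃ * X + z)))        ≡⟨ e X c₁ c₂ c₃ z ⟩
        suc (c₁ + (c₂ + c₃)) * X + z                  ∎
        where
        e : ∀ X c₁ c₂ c₃ z → X + (c₁ * X + (c₂ * X + (c₃ * X + z))) ≡ suc (c₁ + (c₂ + c₃)) * X + z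
        e = solve-∀

      work≡ : work (rounds S (suc k) Tₚ (m , F) T) ≡
        suc (work (parFor m (dpItem F T)) + (work (DP.update T us) + (work (nextFrontier F) + w′)))
      work≡ = cong suc (trans (work->>= (parFor m (dpItem F T)) _) (cong (work (parFor m (dpItem F T)) +_)
        (trans (work->>= (DP.update T us) _) (cong (work (DP.update T us) +_)
          (work->>= (nextFrontier F) _)))))

      span≡ : span (rounds S (suc k) Tₚ (m , F) T) ≡
        suc (span (parFor m (dpItem F T)) + (span (DP.update T us) + (span (nextFrontier F) + s′)))
      span≡ = cong suc (trans (span->>= (parFor m (dpItem F T)) _) (cong (span (parFor m (dpItem F T)) +_)
        (trans (span->>= (DP.update T us) _) (cong (span (DP.update T us) +_)
          (span->>= (nextFrontier F) _)))))

      workBound : work (rounds S (suc k) Tₚ (m , F) T) ≤ roundCost * (N * ℓ) + w′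
      workBound = chain (N * ℓ) (2 + (DP.c + 3) + 4) DP.c (2 * suc M.c + 10) (ℕ.*-mono-< {0} {N} (s≤s z≤n) 0<ℓ) work≡ (Costs.work≤ costs₁) (Costs.work≤ costs₂) (Costs.work≤ costs₃)

      spanBound : span (rounds S (suc k) Tₚ (m , F) T) ≤ roundCost * ℓ + s′
      spanBound = chain ℓ (2 + (DP.c + 3) + 4) DP.c (2 * suc M.c + 10) 0<ℓ span≡ (Costs.span≤ costs₁) (Costs.span≤ costs₂) (Costs.span≤ costs₃)

      regroup : ∀ c ℓ m m′ w s → (c * (2 * (m + m′) * ℓ) + w) + 2 * (c * ℓ) * (2 * s + m) ≡
        w + 2 * (c * ℓ) * (2 * (s + m) + m′)
      regroup = solve-∀
      regroup′ : ∀ a s d → (a + s) + a * d ≡ s + a * suc d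
      regroup′ = solve-∀

    outcome : Outcome (suc n) 0 F₀ T₀
    outcome = rounds-outcome (suc n) (ℕ.+-identityʳ (suc n)) z≤n z≤n level₀ filled₀

    -- Cost of the whole run

    module _ (0<R : 0 < R) where

      private
        X = suc n * ℓ
        Y = R * ℓ

      0<X : 0 < X
      0<X = s≤s z≤n

      ℓ≤Y : ℓ ≤ Y
      ℓ≤Y = ℕ.≤-trans (ℕ.≤-reflexive (sym (ℕ.*-identityˡ ℓ))) (ℕ.*-monoˡ-≤ ℓ 0<R)

      -- The stages before the rounds have span O(ℓ), which fits into R * ℓ since `R` is positive.
      lift : ∀ {A : Set} {a} {p : Comp A} → Costs (suc n * ℓ) ℓ a p → Costs X Y a p
      lift = Costs-mono ℕ.≤-refl ℓ≤Y ℕ.≤-refl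

      bind : ∀ {A B : Set} {a b} (p : Comp A) {f : A → Comp B} →
        Costs (suc n * ℓ) ℓ a p → Costs X Y b (f (run p)) → Costs X Y (a + b) (p >>= f)
      bind p cost₁ cost₂ = lift cost₁ >>=ᶜ cost₂

      log≤ : ∀ {m} → m ≤ n → ⌈log₂ m ⌉ ≤ ℓ
      log≤ = ⌈log₂n⌉≤lg

      entries-Costs : ∀ {B : Set} (f : Activity → B) →
        Costs (suc n * ℓ) ℓ (2 + 4) (parFor n (λ i → load S i >>= λ a → instr (f a)))
      entries-Costs f = parFor-Costs 0<ℓ (log≤ ℕ.≤-refl) ℕ.≤-refl λ i → Costs-tick 0<ℓ 0<ℓ (Costs-instr 0<ℓ 0<ℓ)

      build-Costs : ∀ {A : Set} {a} {p : Comp A} → work p ≤ a * suc n → span p ≤ a * ℓ → Costs (suc n * ℓ) ℓ a p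
      build-Costs {a = a} w s = ℕ.≤-trans w (ℕ.*-monoʳ-≤ a (m≤m*ℓ 0<ℓ (suc n))) , s

      findPivot-Costs : ∀ x → Costs ℓ ℓ (1 + (Start.c + 1)) (findPivot S Tₛ x)
      findPivot-Costs x = Costs-tick 0<ℓ 0<ℓ
        (sequential {p = Start.rangeMax Tₛ (start (lookup S x))} (Start.rangeMax-work Tₛ _) >>=ᶜ Costs-instr 0<ℓ 0<ℓ)

      pivotPair-Costs : ∀ x → Costs ℓ ℓ 2 (pivotPair S pivots x)
      pivotPair-Costs x with pivot x
      ... | just _  = Costs-tick 0<ℓ 0<ℓ (Costs-instr 0<ℓ 0<ℓ)
      ... | nothing = Costs-tick 0<ℓ 0<ℓ (Costs-instr 0<ℓ 0<ℓ)

      pivotPair-height : ∀ x → height (run (pivotPair S pivots x)) ≤ 2 * ℓ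
      pivotPair-height x with pivot x
      ... | just _  = z≤n
      ... | nothing = z≤n

      rankOne-Costs : ∀ x → Costs ℓ ℓ 2 (rankOne S pivots x)
      rankOne-Costs x with pivot x
      ... | just _  = Costs-tick 0<ℓ 0<ℓ (Costs-instr 0<ℓ 0<ℓ)
      ... | nothing = Costs-tick 0<ℓ 0<ℓ (Costs-instr 0<ℓ 0<ℓ)

      rankOne-height : ∀ x → height (run (rankOne S pivots x)) ≤ 2 * ℓ
      rankOne-height x with pivot x
      ... | just _  = z≤n
      ... | nothing = z≤n

      -- The 4 comes from the work: 2 * roundCost * ℓ for each unit of a potential of at most 2 * n.
      -- The span is padded to the same constant, and the 1 pays for the last emptiness test.
      rounds-Costs : Costs X Y (4 * roundCost + 1) (rounds S (suc n) Tₚ F₀ T₀)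
      rounds-Costs =
        (begin
          work (rounds S (suc n) Tₚ F₀ T₀)          ≤⟨ ℕ.m≤m+n _ _ ⟩
          _                                        ≤⟨ work-bound ⟩
          2 * (roundCost * ℓ) * (2 * n) + 1        ≤⟨ ℕ.+-monoʳ-≤ (2 * (roundCost * ℓ) * (2 * n)) 0<X ⟩
          2 * (roundCost * ℓ) * (2 * n) + X        ≤⟨ ℕ.m≤m+n _ (4 * roundCost * ℓ) ⟩
          2 * (roundCost * ℓ) * (2 * n) + X + 4 * roundCost * ℓ ≡⟨ e₁ roundCost n ℓ ⟩
          (4 * roundCost + 1) * X                  ∎) ,
        (begin
          span (rounds S (suc n) Tₚ F₀ T₀)          ≤⟨ ℕ.m≤m+n _ _ ⟩
          _                                        ≤⟨ span-bound ⟩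
          roundCost * ℓ * R + 1                    ≤⟨ ℕ.+-monoʳ-≤ (roundCost * ℓ * R) (ℕ.≤-trans 0<ℓ ℓ≤Y) ⟩
          roundCost * ℓ * R + Y                    ≤⟨ ℕ.m≤m+n _ (3 * (roundCost * Y)) ⟩
          roundCost * ℓ * R + Y + 3 * (roundCost * Y) ≡⟨ e₂ roundCost ℓ R ⟩
          (4 * roundCost + 1) * Y                  ∎)
        where
        open ℕ.≤-Reasoning
        open Outcome outcome
        e₁ : ∀ c n ℓ → 2 * (c * ℓ) * (2 * n) + suc n * ℓ + 4 * c * ℓ ≡ (4 * c + 1) * (suc n * ℓ)
        e₁ = solve-∀
        e₂ : ∀ c ℓ R → c * ℓ * R + R * ℓ + 3 * (c * (R * ℓ)) ≡ (4 * c + 1) * (R * ℓ)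
        e₂ = solve-∀

      type2-Costs : Costs X Y (totalConstant Start.c DP.c M.c) (type2 S)
      type2-Costs =
        bind (parFor n startEntry) (entries-Costs λ a → end a , just (start a))
          (bind (Start.build es) (build-Costs (Start.build-work es es-sorted) (Start.build-span es es-sorted))
          (bind (parFor n (findPivot S Tₛ)) (parFor-Costs 0<ℓ (log≤ ℕ.≤-refl) ℕ.≤-refl findPivot-Costs)
          (bind (collect n (pivotPair S pivots))
            (collect-Costs 0<ℓ (log≤ ℕ.≤-refl) (log≤ ps-length) ℕ.≤-refl (s≤s ps-length) pivotPair-Costs pivotPair-height)
          (bind (M.fromPairs (proj₂ ps))
            (ℕ.≤-trans (M.fromPairs-work (proj₂ ps) ps-length)
               (ℕ.*-monoʳ-≤ M.c (ℕ.*-monoˡ-≤ ℓ (s≤s ps-length))) ,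
             M.fromPairs-span (proj₂ ps) ps-length)
          (bind (parFor n dpEntry) (entries-Costs λ a → end a , nothing)
          (bind (DP.build es′) (build-Costs (DP.build-work es′ es′-sorted) (DP.build-span es′ es′-sorted))
          (bind (collect n (rankOne S pivots))
            (collect-Costs 0<ℓ (log≤ ℕ.≤-refl) (log≤ (level-length level₀)) ℕ.≤-refl (s≤s (level-length level₀))
              rankOne-Costs rankOne-height)
          rounds-Costs)))))))

  -- Result of the run and final bounds

  run-type2 : run (type2 S) ≡ run (rounds S (suc n) Tₚ F₀ T₀)
  run-type2 =
    trans (run->>= (parFor n startEntry) _)
    (trans (run->>= (Start.build es) _)
    (trans (run->>= (parFor n (findPivot S Tₛ)) _)
    (trans (run->>= (collect n (pivotPair S pivots)) _)
    (trans (run->>= (M.fromPairs (proj₂ ps)) _)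
    (trans (run->>= (parFor n dpEntry) _)
    (trans (run->>= (DP.build es′) _)
    (run->>= (collect n (rankOne S pivots)) _)))))))

  computes-dp : Computes S dp
  computes-dp with Rounds.Outcome.result (Rounds.outcome n depth<n)
  ... | T′ , run≡ , holds-dp = T′ , trans run-type2 run≡ , holds-dp

  module _ (2≤n : 2 ≤ n) where

    private
      lb = ⌊log₂ n ⌋
      total = totalConstant Start.c DP.c M.c

    0<lb : 0 < lb
    0<lb = ⌊log₂⌋-mono-≤ 2≤n

    ℓ≤2lb : ℓ ≤ 2 * lb
    ℓ≤2lb = ℕ.+-mono-≤ 0<lb (ℕ.≤-reflexive (sym (ℕ.+-identityʳ lb)))

    -- The 4 is the product of two doublings, n + 1 ≤ 2 n and ℓ ≤ 2 ⌊log₂ n⌋.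
    work-type2 : work (type2 S) ≤ 4 * total * (n * lb)
    work-type2 = begin
      work (type2 S)                ≤⟨ Costs.work≤ (Rounds.type2-Costs n depth<n 0<n) ⟩
      total * (suc n * ℓ)           ≤⟨ ℕ.*-monoʳ-≤ total (ℕ.*-mono-≤ 1+n≤2n ℓ≤2lb) ⟩
      total * (2 * n * (2 * lb))    ≡⟨ e total n lb ⟩
      4 * total * (n * lb)          ∎
      where
      open ℕ.≤-Reasoning
      0<n : 0 < n
      0<n = ℕ.≤-trans (s≤s z≤n) 2≤n
      1+n≤2n : suc n ≤ 2 * n
      1+n≤2n = ℕ.+-mono-≤ 0<n (ℕ.≤-reflexive (sym (ℕ.+-identityʳ n)))
      e : ∀ c n l → c * (2 * n * (2 * l)) ≡ 4 * c * (n * l)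
      e = solve-∀

    span-type2 : ∀ r → IsRank S r → span (type2 S) ≤ 4 * total * (r * lb)
    span-type2 r isRank = begin
      span (type2 S)                ≤⟨ Costs.span≤ (Rounds.type2-Costs r (depth<rank isRank) 0<r) ⟩
      total * (r * ℓ)               ≤⟨ ℕ.*-monoʳ-≤ total (ℕ.*-monoʳ-≤ r ℓ≤2lb) ⟩
      -- A second copy raises the factor from 2 to the 4 of the work bound.
      total * (r * (2 * lb))        ≤⟨ ℕ.m≤m+n _ _ ⟩
      total * (r * (2 * lb)) + total * (r * (2 * lb)) ≡⟨ e total r lb ⟩
      4 * total * (r * lb)          ∎
      where
      open ℕ.≤-Reasoning
      0<r : 0 < r
      -- As n is at least 2 there is an activity, and its depth lies below the rank.
      0<r = ℕ.≤-trans (s≤s z≤n) (depth<rank isRank (Fin.fromℕ< 2≤n))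
      e : ∀ c r l → c * (r * (2 * l)) + c * (r * (2 * l)) ≡ 4 * c * (r * l)
      e = solve-∀

theorem5p2 : (time : DecTotalOrder 0ℓ 0ℓ 0ℓ) (weights : OrderedMonoid)
    (startTrees : RangeMaxTrees time time)
    (dpTrees : RangeMaxTrees time (OrderedMonoid.decTotalOrder weights))
    (pivotMaps : MultiMaps) →
    let open ActivitySelection time weights
        open Type2 startTrees dpTrees pivotMaps
    in
    ∃ λ (c : ℕ) → ∀ (n : ℕ) (S : Vec Activity n) → SortedByEnd S →
      (∃ λ (dp : Fin n → OrderedMonoid.Carrier weights) → Computes S dp × IsSolution S dp)
      × (2 ≤ n →
          work (type2 S) ≤ c * (n * ⌊log₂ n ⌋)
          × (∀ (r : ℕ) → IsRank S r → span (type2 S) ≤ c * (r * ⌊log₂ n ⌋)))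
theorem5p2 time weights startTrees dpTrees pivotMaps =
  4 * totalConstant (RangeMaxTrees.c startTrees) (RangeMaxTrees.c dpTrees) (MultiMaps.c pivotMaps) ,
  λ n S sorted →
    let open Algorithm time weights startTrees dpTrees pivotMaps S sorted
        open SortedActivities time weights S sorted
    in
    (dp , computes-dp , dp-isSolution) , λ 2≤n → work-type2 2≤n , span-type2 2≤n
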